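{- Let $\lambda\in\mathbb{R}$, let $r\ge s\ge 1$ be integers and let $n\ge 1$ be an integer. Then \[ \phi_{n,\lambda}^{(r,s)}(x)=\frac{1}{e^{x}}\sum_{k=0}^{\infty}\frac{1}{k!}\bigg(\prod_{j=1}^{n}\big[(k+(j-1)(r-s))_s-(n-j)\lambda\big]\bigg)x^{k}. \] In particular, for $x=1$, \[ \phi_{n,\lambda}^{(r,s)}=\frac{1}{e}\sum_{k=0}^{\infty}\frac{1}{k!}\bigg(\prod_{j=1}^{n}\big[(k+(j-1)(r-s))_s-(n-j)\lambda\big]\bigg). \]
   Context: Notation: $(x)_0=1$, $(x)_m=x(x-1)\cdots(x-m+1)$ for $m\ge1$ (falling factorial). Let $D=\frac{d}{dx}$ and let $x$ also denote the operator of multiplication by $x$ (acting on polynomials/smooth functions). The generalized degenerate $(r,s)$-Stirling numbers of the second kind $S_\lambda^{(r,s)}(n,k)$, $0\le k\le ns$, are defined by the operator identity \[ \prod_{k=0}^{n-1}\Big(x^{r}D^{s}-k\lambda\, x^{r-s}\Big)=x^{n(r-s)}\sum_{k=0}^{ns}S_\lambda^{(r,s)}(n,k)\,x^{k}D^{k}, \] where the product of operators is written with the factors $k=0,1,\dots,n-1$ from left to right. The generalized degenerate $(r,s)$-Bell polynomials are $\phi_{n,\lambda}^{(r,s)}(x)=\sum_{k=0}^{ns}S_\lambda^{(r,s)}(n,k)x^k$, and $\phi_{n,\lambda}^{(r,s)}=\phi_{n,\lambda}^{(r,s)}(1)$. -}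

module Defs where

open import Algebra.Bundles using (CommutativeRing; CommutativeSemiring)
open import Data.Integer.Base using (+_)
import Data.Integer.Properties as ℤ
open import Data.List.Base using (List; []; _∷_; map)
open import Data.Nat.Base as ℕ using (ℕ; zero; suc; _!; _∸_)
open import Data.Nat.Coprimality as Coprimality using (1-coprimeTo)
open import Data.Nat.Properties as ℕ using (_!≢0)
open import Data.Product.Base using (∃; _×_; _,_; proj₁; proj₂)
open import Data.Rational.Base as ℚ using (ℚ; mkℚ; 0ℚ; 1ℚ; ½)
import Data.Rational.Properties as ℚ
open import Data.Rational.Solver using (module +-*-Solver)
open import Data.Sum.Base using (inj₁; inj₂; [_,_]′)
open import Function.Base using (id; _∘_; _∘′_; _$_)
open import Level using (0ℓ)
open import Relation.Binary.PropositionalEquality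
open import Relation.Nullary.Decidable.Core using (yes; no)
open import Relation.Nullary.Negation.Core using (contradiction)

fold< : ∀ {a} {A : Set a} → (A → A → A) → A → ℕ → (ℕ → A) → A
fold< _·_ e zero    f = e
fold< _·_ e (suc n) f = fold< _·_ e n f · f n

Eventually : (ℕ → Set) → Set
Eventually P = ∃ λ N → ∀ n → N ℕ.≤ n → P n

IsCauchy : (ℕ → ℚ) → Set
IsCauchy u = ∀ ε → 0ℚ ℚ.< ε →
  ∃ λ N → ∀ m n → N ℕ.≤ m → N ℕ.≤ n → ℚ.∣ u m ℚ.- u n ∣ ℚ.≤ ε

_∧ᵉ_ : ∀ {P Q : ℕ → Set} → Eventually P → Eventually Q → Eventually (λ n → P n × Q n)
(M , p) ∧ᵉ (N , q) = M ℕ.⊔ N , λ n h →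
  p n (ℕ.≤-trans (ℕ.m≤m⊔n M N) h) , q n (ℕ.≤-trans (ℕ.m≤n⊔m M N) h)

mapᵉ : ∀ {P Q : ℕ → Set} → (∀ n → P n → Q n) → Eventually P → Eventually Q
mapᵉ f (N , p) = N , λ n h → f n (p n h)

module RationalLemmas where
  open import Data.Rational.Base hiding (_/_)
  open import Data.Rational.Properties
  open +-*-Solver

  ι : ℕ → ℚ
  ι n = + n ℚ./ 1

  1/! : ℕ → ℚ
  1/! k = (+ 1 ℚ./ (k !)) {{k !≢0}}

  private
    ι′ : ℕ → ℚ
    ι′ n = mkℚ (+ n) 0 (Coprimality.sym (1-coprimeTo n))

    ι≡ι′ : ∀ n → ι n ≡ ι′ n
    ι≡ι′ n = ↥p/↧p≡p (ι′ n)

  ι-+ : ∀ m n → ι (m ℕ.+ n) ≡ ι m + ι n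
  ι-+ m n = sym $ trans (cong₂ _+_ (ι≡ι′ m) (ι≡ι′ n))
    (/-cong {q₁ = 1} (cong₂ Data.Integer.Base._+_ (ℤ.*-identityʳ (+ m)) (ℤ.*-identityʳ (+ n))) refl)

  ι-* : ∀ m n → ι (m ℕ.* n) ≡ ι m * ι n
  ι-* m n = sym $ trans (cong₂ _*_ (ι≡ι′ m) (ι≡ι′ n))
    (/-cong {q₁ = 1} (sym (ℤ.pos-* m n)) refl)

  recip : ∀ n .{{_ : ℕ.NonZero n}} → ι n * (+ 1 ℚ./ n) ≡ 1ℚ
  recip (suc n) = trans (cong₂ _*_ (ι≡ι′ (suc n)) (↥p/↧p≡p (mkℚ (+ 1) n (1-coprimeTo (suc n)))))
    (*-inverseʳ (ι′ (suc n)))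

  ι-nonNeg : ∀ n → 0ℚ ≤ ι n
  ι-nonNeg n = nonNegative⁻¹ (ι n) {{normalize-nonNeg n 1}}

  ≡≤ : ∀ {a b c} → a ≡ b → b ≤ c → a ≤ c
  ≡≤ e = ≤-trans (≤-reflexive e)

  archimedean : ∀ q → ∃ λ N → q ≤ ι N
  archimedean q with ∣ q ∣ in eq
  ... | mkℚ (+ n) d c = n , ≤-trans (q≤∣q∣ q) (≤-trans (≤-reflexive eq)
          (≤-trans (*≤* (ℤ.*-monoˡ-≤-nonNeg (+ n) (Data.Integer.Base.+≤+ (ℕ.s≤s ℕ.z≤n))))
            (≤-reflexive (sym (ι≡ι′ n)))))
    where
    q≤∣q∣ : ∀ p → p ≤ ∣ p ∣
    q≤∣q∣ p with ≤-total 0ℚ p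
    ... | inj₁ h = ≤-reflexive (sym (0≤p⇒∣p∣≡p h))
    ... | inj₂ h = ≤-trans h (0≤∣p∣ p)
  ... | mkℚ Data.Integer.Base.-[1+ n ] d c = contradiction (subst (0ℚ ≤_) eq (0≤∣p∣ q)) (λ { (*≤* ()) })

  *-mono : ∀ {a b c d} → 0ℚ ≤ a → a ≤ b → 0ℚ ≤ c → c ≤ d → a * c ≤ b * d
  *-mono {b = b} {c} p q r s = ≤-trans
    (*-monoʳ-≤-nonNeg c {{nonNegative r}} q)
    (*-monoˡ-≤-nonNeg b {{nonNegative (≤-trans p q)}} s)

  *-nonNeg : ∀ {a b} → 0ℚ ≤ a → 0ℚ ≤ b → 0ℚ ≤ a * b
  *-nonNeg {a} {b} p q = subst (_≤ a * b) (*-zeroˡ 0ℚ) (*-mono ≤-refl p ≤-refl q)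

  *-pos : ∀ {a b} → 0ℚ < a → 0ℚ < b → 0ℚ < a * b
  *-pos {a} {b} p q = positive⁻¹ (a * b) {{pos*pos⇒pos a {{positive p}} b {{positive q}}}}

  +-pos : ∀ {a b} → 0ℚ < a → 0ℚ ≤ b → 0ℚ < a + b
  +-pos = +-mono-<-≤

  ∣*∣-mono : ∀ a b {c d} → ∣ a ∣ ≤ c → ∣ b ∣ ≤ d → ∣ a * b ∣ ≤ c * d
  ∣*∣-mono a b p q = ≡≤ (∣p*q∣≡∣p∣*∣q∣ a b) (*-mono (0≤∣p∣ a) p (0≤∣p∣ b) q)

  ∣+∣-mono : ∀ a b {c d} → ∣ a ∣ ≤ c → ∣ b ∣ ≤ d → ∣ a + b ∣ ≤ c + d
  ∣+∣-mono a b p q = ≤-trans (∣p+q∣≤∣p∣+∣q∣ a b) (+-mono-≤ p q)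

  half-pos : ∀ {ε} → 0ℚ < ε → 0ℚ < ½ * ε
  half-pos = *-pos (positive⁻¹ ½)

  halves : ∀ ε → ½ * ε + ½ * ε ≡ ε
  halves = solve 1 (λ ε → con ½ :* ε :+ con ½ :* ε := ε) refl

  ∣-∣-sym : ∀ a b → ∣ a - b ∣ ≡ ∣ b - a ∣
  ∣-∣-sym a b = trans (sym (∣-p∣≡∣p∣ (a - b)))
    (cong ∣_∣ (solve 2 (λ a b → :- (a :- b) := b :- a) refl a b))

  ∣-∣-triangle : ∀ a b c {δ ε} → ∣ a - b ∣ ≤ δ → ∣ b - c ∣ ≤ ε → ∣ a - c ∣ ≤ δ + ε
  ∣-∣-triangle a b c p q = subst (λ t → ∣ t ∣ ≤ _)
    (solve 3 (λ a b c → (a :- b) :+ (b :- c) := a :- c) refl a b c)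
    (∣+∣-mono (a - b) (b - c) p q)

  ∣-∣-triangle½ : ∀ a b c {ε} → ∣ a - b ∣ ≤ ½ * ε → ∣ b - c ∣ ≤ ½ * ε → ∣ a - c ∣ ≤ ε
  ∣-∣-triangle½ a b c {ε} p q = subst (∣ a - c ∣ ≤_) (halves ε) (∣-∣-triangle a b c p q)

  ∣-∣-refl : ∀ {a b ε} → a ≡ b → 0ℚ < ε → ∣ a - b ∣ ≤ ε
  ∣-∣-refl {a} refl p = subst (λ t → ∣ t ∣ ≤ _) (sym (+-inverseʳ a)) (<⇒≤ p)

  -- |a| ≤ |a - b| + |b|
  ∣∣-shift : ∀ a b {δ ε} → ∣ a - b ∣ ≤ δ → ∣ b ∣ ≤ ε → ∣ a ∣ ≤ δ + ε
  ∣∣-shift a b p q = subst (λ t → ∣ t ∣ ≤ _)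
    (solve 2 (λ a b → (a :- b) :+ b := a) refl a b) (∣+∣-mono (a - b) b p q)

  ∣∣-difference : ∀ a b → ∣ a ∣ - ∣ b ∣ ≤ ∣ a - b ∣
  ∣∣-difference a b = subst (∣ a ∣ - ∣ b ∣ ≤_)
    (solve 2 (λ x y → x :+ y :- y := x) refl ∣ a - b ∣ ∣ b ∣)
    (+-monoˡ-≤ (- ∣ b ∣) (∣∣-shift a b ≤-refl ≤-refl))

  -- ||a| - |b|| ≤ |a - b|
  ∣∣-lipschitz : ∀ a b → ∣ ∣ a ∣ - ∣ b ∣ ∣ ≤ ∣ a - b ∣
  ∣∣-lipschitz a b with ∣p∣≡p∨∣p∣≡-p (∣ a ∣ - ∣ b ∣)
  ... | inj₁ e = ≡≤ e (∣∣-difference a b)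
  ... | inj₂ e = ≡≤ (trans e (solve 2 (λ x y → :- (x :- y) := y :- x) refl ∣ a ∣ ∣ b ∣))
                    (≤-trans (∣∣-difference b a) (≤-reflexive (∣-∣-sym b a)))

  divide : ∀ B ε → 0ℚ < B → 0ℚ < ε → ∃ λ δ → 0ℚ < δ × B * δ ≡ ε
  divide B ε p q = 1/B * ε , *-pos (positive⁻¹ 1/B {{1/pos⇒pos B}}) q ,
      trans (sym (*-assoc B 1/B ε)) (trans (cong (_* ε) (*-inverseʳ B)) (*-identityˡ ε))
    where
    instance
      _ = positive p
      _ = pos⇒nonZero B
    1/B = 1/ B

  bounded : ∀ u → IsCauchy u → ∃ λ M → ∀ n → ∣ u n ∣ ≤ ι (suc M)
  bounded u c with c 1ℚ (positive⁻¹ 1ℚ)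
  ... | N , h = proj₁ tot , λ n → ≤-trans (bnd n) (≤-trans (proj₂ tot) (ι≤ (proj₁ tot)))
    where
    ι≤ : ∀ n → ι n ≤ ι (suc n)
    ι≤ n = subst₂ _≤_ (+-identityˡ (ι n)) (sym (ι-+ 1 n)) (+-monoˡ-≤ (ι n) (nonNegative⁻¹ 1ℚ))
    S = fold< _+_ 0ℚ N (λ k → ∣ u k ∣)
    S≥0 : ∀ n → 0ℚ ≤ fold< _+_ 0ℚ n (λ k → ∣ u k ∣)
    S≥0 zero = ≤-refl
    S≥0 (suc n) = +-mono-≤ (S≥0 n) (0≤∣p∣ (u n))
    below : ∀ n k → k ℕ.< n → ∣ u k ∣ ≤ fold< _+_ 0ℚ n (λ k → ∣ u k ∣)
    below (suc n) k k<sn with k ℕ.≟ n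
    ... | yes refl = ≡≤ (sym (+-identityˡ _)) (+-monoˡ-≤ ∣ u k ∣ (S≥0 n))
    ... | no k≢n = ≡≤ (sym (+-identityʳ _))
            (+-mono-≤ (below n k (ℕ.≤∧≢⇒< (ℕ.≤-pred k<sn) k≢n)) (0≤∣p∣ (u n)))
    bnd : ∀ n → ∣ u n ∣ ≤ S + (1ℚ + ∣ u N ∣)
    bnd n with n ℕ.<? N
    ... | yes n<N = ≡≤ (sym (+-identityʳ _))
            (+-mono-≤ (below N n n<N) (+-mono-≤ (nonNegative⁻¹ 1ℚ) (0≤∣p∣ (u N))))
    ... | no n≮N = subst (_≤ _) (+-identityˡ _)
            (+-mono-≤ (S≥0 N) (∣∣-shift (u n) (u N) (h n N (ℕ.≮⇒≥ n≮N) ℕ.≤-refl) ≤-refl))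
    tot = archimedean (S + (1ℚ + ∣ u N ∣))

  ι-pos : ∀ n → 0ℚ < ι (suc n)
  ι-pos n = positive⁻¹ (ι (suc n)) {{normalize-pos (suc n) 1}}

  ι-mono : ∀ {m n} → m ℕ.≤ n → ι m ≤ ι n
  ι-mono {m} {n} m≤n = subst₂ _≤_ (+-identityʳ (ι m)) (trans (sym (ι-+ m (n ∸ m))) (cong ι (ℕ.m+[n∸m]≡n m≤n)))
    (+-monoʳ-≤ (ι m) (ι-nonNeg (n ∸ m)))

  1/suc : ℕ → ℚ
  1/suc n = + 1 ℚ./ suc n

  1/suc-pos : ∀ n → 0ℚ < 1/suc n
  1/suc-pos n = positive⁻¹ (1/suc n) {{normalize-pos 1 (suc n)}}

  1/suc-small : ∀ ε → 0ℚ < ε → Eventually (λ n → 1/suc n ≤ ε)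
  1/suc-small ε 0<ε = proj₁ N , λ n N≤n → begin
      1/suc n                    ≡⟨ *-identityˡ (1/suc n) ⟨
      1ℚ * 1/suc n               ≡⟨ cong (_* 1/suc n) (proj₂ (proj₂ d)) ⟨
      ε * proj₁ d * 1/suc n
        ≤⟨ *-mono (*-nonNeg (<⇒≤ 0<ε) (<⇒≤ (proj₁ (proj₂ d))))
             (*-monoˡ-≤-nonNeg ε {{nonNegative (<⇒≤ 0<ε)}}
               (≤-trans (proj₂ N) (ι-mono (ℕ.≤-trans N≤n (ℕ.n≤1+n n)))))
             (<⇒≤ (1/suc-pos n)) ≤-refl ⟩
      ε * ι (suc n) * 1/suc n    ≡⟨ *-assoc ε (ι (suc n)) (1/suc n) ⟩
      ε * (ι (suc n) * 1/suc n)  ≡⟨ cong (ε *_) (recip (suc n)) ⟩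
      ε * 1ℚ                     ≡⟨ *-identityʳ ε ⟩
      ε                          ∎
    where
    open ≤-Reasoning
    d = divide ε 1ℚ 0<ε (positive⁻¹ 1ℚ)
    N = archimedean (proj₁ d)

  recip₀ : ℚ → ℚ
  recip₀ q with q ≟ 0ℚ
  ... | yes _  = 0ℚ
  ... | no q≢0 = (1/ q) {{≢-nonZero q≢0}}

  recip₀-inverse : ∀ {q δ} → 0ℚ < δ → δ ≤ ∣ q ∣ → q * recip₀ q ≡ 1ℚ
  recip₀-inverse {q} 0<δ δ≤ with q ≟ 0ℚ
  ... | yes refl = contradiction (<-≤-trans 0<δ δ≤) (<-irrefl refl)
  ... | no q≢0   = *-inverseʳ q {{≢-nonZero q≢0}}

  +-close : ∀ a b a′ b′ {ε} → ∣ a - a′ ∣ ≤ ½ * ε → ∣ b - b′ ∣ ≤ ½ * ε → ∣ (a + b) - (a′ + b′) ∣ ≤ ε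
  +-close a b a′ b′ {ε} p q = subst₂ _≤_
    (cong ∣_∣ (solve 4 (λ a b a′ b′ → (a :- a′) :+ (b :- b′) := (a :+ b) :- (a′ :+ b′)) refl a b a′ b′))
    (halves ε) (∣+∣-mono (a - a′) (b - b′) p q)

  *-close : ∀ a b a′ b′ {B δ ε} → ∣ a ∣ ≤ B → ∣ b′ ∣ ≤ B → B * δ ≡ ½ * ε →
    ∣ a - a′ ∣ ≤ δ → ∣ b - b′ ∣ ≤ δ → ∣ a * b - a′ * b′ ∣ ≤ ε
  *-close a b a′ b′ {B} {δ} {ε} α β e p q = subst₂ _≤_
    (cong ∣_∣ (solve 4 (λ a b a′ b′ → a :* (b :- b′) :+ b′ :* (a :- a′) := a :* b :- a′ :* b′) refl a b a′ b′))
    (trans (cong₂ _+_ e e) (halves ε))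
    (∣+∣-mono (a * (b - b′)) (b′ * (a - a′)) (∣*∣-mono a (b - b′) α q) (∣*∣-mono b′ (a - a′) β p))

  neg-close : ∀ a a′ {ε} → ∣ a - a′ ∣ ≤ ε → ∣ (- a) - (- a′) ∣ ≤ ε
  neg-close a a′ p = ≡≤ (trans (cong ∣_∣ (solve 2 (λ a a′ → :- a :- :- a′ := a′ :- a) refl a a′)) (∣-∣-sym a′ a)) p

  recip₀-close : ∀ a b {δ ε} → 0ℚ < δ → δ ≤ ∣ a ∣ → δ ≤ ∣ b ∣ → ∣ a - b ∣ ≤ δ * δ * ε → ∣ recip₀ a - recip₀ b ∣ ≤ ε
  recip₀-close a b {δ} {ε} 0<δ δ≤a δ≤b p = *-cancelˡ-≤-pos (δ * δ) {{positive (*-pos 0<δ 0<δ)}} (begin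
    δ * δ * ∣ x - y ∣
      ≤⟨ *-monoʳ-≤-nonNeg ∣ x - y ∣ {{nonNegative (0≤∣p∣ (x - y))}} (*-mono (<⇒≤ 0<δ) δ≤a (<⇒≤ 0<δ) δ≤b) ⟩
    ∣ a ∣ * ∣ b ∣ * ∣ x - y ∣        ≡⟨ cong (_* ∣ x - y ∣) (∣p*q∣≡∣p∣*∣q∣ a b) ⟨
    ∣ a * b ∣ * ∣ x - y ∣            ≡⟨ ∣p*q∣≡∣p∣*∣q∣ (a * b) (x - y) ⟨
    ∣ a * b * (x - y) ∣
      ≡⟨ cong ∣_∣ (solve 4 (λ a b x y → a :* b :* (x :- y) := (a :* x) :* b :- (b :* y) :* a) refl a b x y) ⟩
    ∣ (a * x) * b - (b * y) * a ∣
      ≡⟨ cong₂ (λ s t → ∣ s * b - t * a ∣) (recip₀-inverse 0<δ δ≤a) (recip₀-inverse 0<δ δ≤b) ⟩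
    ∣ 1ℚ * b - 1ℚ * a ∣              ≡⟨ cong₂ (λ s t → ∣ s - t ∣) (*-identityˡ b) (*-identityˡ a) ⟩
    ∣ b - a ∣                        ≡⟨ ∣-∣-sym b a ⟩
    ∣ a - b ∣                        ≤⟨ p ⟩
    δ * δ * ε                        ∎)
    where
    open ≤-Reasoning
    x = recip₀ a
    y = recip₀ b

module ExponentialBounds where
  open import Data.Rational.Base hiding (_/_)
  open import Data.Rational.Properties
  open +-*-Solver
  open RationalLemmas
  open import Algebra.Definitions.RawSemiring ℚ.+-*-rawSemiring public using (_^_)

  ∑ : ℕ → (ℕ → ℚ) → ℚ
  ∑ = fold< _+_ 0ℚ

  -- Coefficients of the Cauchy product; used to bound exp(q) away from 0 via exp(q) exp(-q) = 1.
  conv : (ℕ → ℚ) → (ℕ → ℚ) → ℕ → ℚ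
  conv a b zero    = a 0 * b 0
  conv a b (suc m) = a 0 * b (suc m) + conv (a ∘ suc) b m

  private
    -- coefficients of the formal derivative
    δ : (ℕ → ℚ) → ℕ → ℚ
    δ a k = ι (suc k) * a (suc k)

    conv-cong : ∀ {a a′ b b′} → (∀ k → a k ≡ a′ k) → (∀ k → b k ≡ b′ k) → ∀ m → conv a b m ≡ conv a′ b′ m
    conv-cong p q zero    = cong₂ _*_ (p 0) (q 0)
    conv-cong p q (suc m) = cong₂ _+_ (cong₂ _*_ (p 0) (q (suc m))) (conv-cong (p ∘ suc) q m)

    conv-+ : ∀ a a′ b m → conv (λ k → a k + a′ k) b m ≡ conv a b m + conv a′ b m
    conv-+ a a′ b zero    = *-distribʳ-+ (b 0) (a 0) (a′ 0)
    conv-+ a a′ b (suc m) = trans (cong (λ t → (a 0 + a′ 0) * b (suc m) + t) (conv-+ (a ∘ suc) (a′ ∘ suc) b m))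
      (solve 5 (λ x y z u v → (x :+ y) :* z :+ (u :+ v) := (x :* z :+ u) :+ (y :* z :+ v)) refl
        (a 0) (a′ 0) (b (suc m)) (conv (a ∘ suc) b m) (conv (a′ ∘ suc) b m))

    conv-minus : ∀ a b b′ m → conv a (λ k → b k - b′ k) m ≡ conv a b m - conv a b′ m
    conv-minus a b b′ zero = solve 3 (λ x y z → x :* (y :- z) := x :* y :- x :* z) refl (a 0) (b 0) (b′ 0)
    conv-minus a b b′ (suc m) = trans (cong (λ t → a 0 * (b (suc m) - b′ (suc m)) + t) (conv-minus (a ∘ suc) b b′ m))
      (solve 5 (λ x y z u v → x :* (y :- z) :+ (u :- v) := (x :* y :+ u) :- (x :* z :+ v)) refl
        (a 0) (b (suc m)) (b′ (suc m)) (conv (a ∘ suc) b m) (conv (a ∘ suc) b′ m))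

    conv-scaleˡ : ∀ c a b m → conv (λ k → c * a k) b m ≡ c * conv a b m
    conv-scaleˡ c a b zero = *-assoc c (a 0) (b 0)
    conv-scaleˡ c a b (suc m) = trans (cong (λ t → c * a 0 * b (suc m) + t) (conv-scaleˡ c (a ∘ suc) b m))
      (solve 4 (λ c x y u → c :* x :* y :+ c :* u := c :* (x :* y :+ u)) refl
        c (a 0) (b (suc m)) (conv (a ∘ suc) b m))

    conv-scaleʳ : ∀ c a b m → conv a (λ k → c * b k) m ≡ c * conv a b m
    conv-scaleʳ c a b zero = solve 3 (λ c x y → x :* (c :* y) := c :* (x :* y)) refl c (a 0) (b 0)
    conv-scaleʳ c a b (suc m) = trans (cong (λ t → a 0 * (c * b (suc m)) + t) (conv-scaleʳ c (a ∘ suc) b m))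
      (solve 4 (λ c x y u → x :* (c :* y) :+ c :* u := c :* (x :* y :+ u)) refl
        c (a 0) (b (suc m)) (conv (a ∘ suc) b m))

    leibniz : ∀ a b m → δ (conv a b) m ≡ conv (δ a) b m + conv a (δ b) m
    leibniz a b zero = solve 5 (λ i x y u v → i :* (x :* v :+ y :* u) := (i :* y) :* u :+ x :* (i :* v)) refl
      (ι 1) (a 0) (a 1) (b 0) (b 1)
    leibniz a b (suc m) = begin
      ι (2 ℕ.+ m) * (a 0 * b (2 ℕ.+ m) + (a 1 * b (suc m) + C₂))
        ≡⟨ cong (_* (a 0 * b (2 ℕ.+ m) + (a 1 * b (suc m) + C₂))) (ι-+ 1 (suc m)) ⟩
      (ι 1 + ι (suc m)) * (a 0 * b (2 ℕ.+ m) + (a 1 * b (suc m) + C₂))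
        ≡⟨ solve 6 (λ i j x y z c → (i :+ j) :* (x :* y :+ (z :+ c))
             := (x :* ((i :+ j) :* y) :+ i :* (z :+ c)) :+ j :* (z :+ c)) refl
             (ι 1) (ι (suc m)) (a 0) (b (2 ℕ.+ m)) (a 1 * b (suc m)) C₂ ⟩
      (a 0 * ((ι 1 + ι (suc m)) * b (2 ℕ.+ m)) + ι 1 * (a 1 * b (suc m) + C₂)) + δ (conv (a ∘ suc) b) m
        ≡⟨ cong₂ (λ s t → (a 0 * (s * b (2 ℕ.+ m)) + ι 1 * (a 1 * b (suc m) + C₂)) + t)
             (sym (ι-+ 1 (suc m))) (leibniz (a ∘ suc) b m) ⟩
      (a 0 * δ b (suc m) + ι 1 * (a 1 * b (suc m) + C₂)) + (conv (δ (a ∘ suc)) b m + conv (a ∘ suc) (δ b) m)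
        ≡⟨ solve 7 (λ x i y z c u v → (x :+ i :* (y :* z :+ c)) :+ (u :+ v)
             := ((i :* y) :* z :+ (i :* c :+ u)) :+ (x :+ v)) refl
             (a 0 * δ b (suc m)) (ι 1) (a 1) (b (suc m)) C₂ (conv (δ (a ∘ suc)) b m) (conv (a ∘ suc) (δ b) m) ⟩
      (δ a 0 * b (suc m) + (ι 1 * C₂ + conv (δ (a ∘ suc)) b m)) + (a 0 * δ b (suc m) + conv (a ∘ suc) (δ b) m)
        ≡⟨ cong (λ t → (δ a 0 * b (suc m) + t) + (a 0 * δ b (suc m) + conv (a ∘ suc) (δ b) m)) (sym shifted) ⟩
      conv (δ a) b (suc m) + conv a (δ b) (suc m) ∎
      where
      open ≡-Reasoning
      C₂ = conv (a ∘ suc ∘ suc) b m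
      shifted : conv (δ a ∘ suc) b m ≡ ι 1 * C₂ + conv (δ (a ∘ suc)) b m
      shifted = begin
        conv (δ a ∘ suc) b m
          ≡⟨ conv-cong (λ k → trans (cong (λ t → t * a (2 ℕ.+ k)) (ι-+ 1 (suc k)))
               (*-distribʳ-+ (a (2 ℕ.+ k)) (ι 1) (ι (suc k)))) (λ _ → refl) m ⟩
        conv (λ k → ι 1 * a (2 ℕ.+ k) + δ (a ∘ suc) k) b m
          ≡⟨ conv-+ (λ k → ι 1 * a (2 ℕ.+ k)) (δ (a ∘ suc)) b m ⟩
        conv (λ k → ι 1 * a (2 ℕ.+ k)) b m + conv (δ (a ∘ suc)) b m
          ≡⟨ cong (λ t → t + conv (δ (a ∘ suc)) b m) (conv-scaleˡ (ι 1) (a ∘ suc ∘ suc) b m) ⟩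
        ι 1 * C₂ + conv (δ (a ∘ suc)) b m ∎

    conv-sums : ∀ a b n → conv a (λ k → ∑ (suc k) b) n + conv a b (suc n) ≡ conv a (λ k → ∑ (suc k) b) (suc n)
    conv-sums a b zero = trans
      (solve 5 (λ x y u v o → x :* (o :+ u) :+ (x :* v :+ y :* u) := x :* (o :+ u :+ v) :+ y :* u) refl
        (a 0) (a 1) (b 0) (b 1) 0ℚ)
      (cong (λ t → a 0 * ∑ 2 b + a 1 * t) (sym (+-identityˡ (b 0))))
    conv-sums a b (suc n) = trans
      (solve 5 (λ x s c t d → (x :* s :+ c) :+ (x :* t :+ d) := x :* (s :+ t) :+ (c :+ d)) refl
        (a 0) (∑ (2 ℕ.+ n) b) (conv (a ∘ suc) (λ k → ∑ (suc k) b) n) (b (2 ℕ.+ n)) (conv (a ∘ suc) b (suc n)))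
      (cong (λ t → a 0 * ∑ (3 ℕ.+ n) b + t) (conv-sums (a ∘ suc) b n))

    ∑-conv : ∀ a b n → ∑ (suc n) (conv a b) ≡ conv a (λ k → ∑ (suc k) b) n
    ∑-conv a b zero = trans (+-identityˡ (a 0 * b 0)) (cong (λ t → a 0 * t) (sym (+-identityˡ (b 0))))
    ∑-conv a b (suc n) = trans (cong (_+ conv a b (suc n)) (∑-conv a b n)) (conv-sums a b n)

    ∑-front : ∀ a n → ∑ (suc n) a ≡ a 0 + ∑ n (a ∘ suc)
    ∑-front a zero = +-comm 0ℚ (a 0)
    ∑-front a (suc n) = trans (cong (_+ a (suc n)) (∑-front a n)) (+-assoc (a 0) (∑ n (a ∘ suc)) (a (suc n)))

    conv-const : ∀ a c n → conv a (λ _ → c) n ≡ ∑ (suc n) a * c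
    conv-const a c zero = cong (_* c) (sym (+-identityˡ (a 0)))
    conv-const a c (suc n) = trans (cong (λ t → a 0 * c + t) (conv-const (a ∘ suc) c n))
      (trans (sym (*-distribʳ-+ c (a 0) (∑ (suc n) (a ∘ suc)))) (cong (_* c) (sym (∑-front a (suc n)))))

    h : ℚ
    h = ½ * ½

  term : ℚ → ℕ → ℚ
  term q k = 1/! k * q ^ k

  private
    1/!-suc : ∀ k → ι (suc k) * 1/! (suc k) ≡ 1/! k
    1/!-suc k = begin
      ι (suc k) * 1/! (suc k)                          ≡⟨ *-identityʳ (ι (suc k) * 1/! (suc k)) ⟨
      ι (suc k) * 1/! (suc k) * 1ℚ                     ≡⟨ cong (λ t → ι (suc k) * 1/! (suc k) * t) (recip (k !) {{k !≢0}}) ⟨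
      ι (suc k) * 1/! (suc k) * (ι (k !) * 1/! k)
        ≡⟨ solve 4 (λ x y z w → x :* y :* (z :* w) := (x :* z) :* y :* w) refl (ι (suc k)) (1/! (suc k)) (ι (k !)) (1/! k) ⟩
      (ι (suc k) * ι (k !)) * 1/! (suc k) * 1/! k      ≡⟨ cong (λ t → t * 1/! (suc k) * 1/! k) (ι-* (suc k) (k !)) ⟨
      ι ((suc k) !) * 1/! (suc k) * 1/! k              ≡⟨ cong (_* 1/! k) (recip ((suc k) !) {{(suc k) !≢0}}) ⟩
      1ℚ * 1/! k                                       ≡⟨ *-identityˡ (1/! k) ⟩
      1/! k                                            ∎
      where open ≡-Reasoning

    δ-term : ∀ q k → δ (term q) k ≡ q * term q k
    δ-term q k = trans
      (solve 4 (λ i f q p → i :* (f :* (q :* p)) := q :* ((i :* f) :* p)) refl (ι (suc k)) (1/! (suc k)) q (q ^ k))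
      (cong (λ t → q * (t * q ^ k)) (1/!-suc k))

    ι-cancel : ∀ n {x} → ι (suc n) * x ≡ 0ℚ → x ≡ 0ℚ
    ι-cancel n {x} e = begin
      x                                              ≡⟨ *-identityˡ x ⟨
      1ℚ * x                                         ≡⟨ cong (_* x) (recip (suc n)) ⟨
      ι (suc n) * (+ 1 ℚ./ suc n) * x                ≡⟨ solve 3 (λ i r x → i :* r :* x := r :* (i :* x)) refl (ι (suc n)) (+ 1 ℚ./ suc n) x ⟩
      (+ 1 ℚ./ suc n) * (ι (suc n) * x)              ≡⟨ cong (λ t → (+ 1 ℚ./ suc n) * t) e ⟩
      (+ 1 ℚ./ suc n) * 0ℚ                           ≡⟨ *-zeroʳ (+ 1 ℚ./ suc n) ⟩
      0ℚ ∎
      where open ≡-Reasoning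

    conv-term-suc : ∀ q m → conv (term q) (term (- q)) (suc m) ≡ 0ℚ
    conv-term-suc q m = ι-cancel m (begin
      δ (conv (term q) (term (- q))) m
        ≡⟨ leibniz (term q) (term (- q)) m ⟩
      conv (δ (term q)) (term (- q)) m + conv (term q) (δ (term (- q))) m
        ≡⟨ cong₂ _+_ (conv-cong (δ-term q) (λ _ → refl) m) (conv-cong (λ _ → refl) (δ-term (- q)) m) ⟩
      conv (λ k → q * term q k) (term (- q)) m + conv (term q) (λ k → - q * term (- q) k) m
        ≡⟨ cong₂ _+_ (conv-scaleˡ q (term q) (term (- q)) m) (conv-scaleʳ (- q) (term q) (term (- q)) m) ⟩
      q * C + - q * C
        ≡⟨ solve 2 (λ q c → q :* c :+ :- q :* c := con 0ℚ) refl q C ⟩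
      0ℚ ∎)
      where
      open ≡-Reasoning
      C = conv (term q) (term (- q)) m

    ∑-conv-term : ∀ q n → ∑ (suc n) (conv (term q) (term (- q))) ≡ 1ℚ
    ∑-conv-term q zero    = refl
    ∑-conv-term q (suc n) = trans (cong₂ _+_ (∑-conv-term q n) (conv-term-suc q n)) (+-identityʳ 1ℚ)

    product-error : ∀ q n → let A = ∑ (suc n) (term q); B = ∑ (suc n) (term (- q)) in
      A * B - 1ℚ ≡ conv (term q) (λ k → B - ∑ (suc k) (term (- q))) n
    product-error q n = sym (trans (conv-minus (term q) _ _ n)
      (cong₂ _-_ (conv-const (term q) _ n)
        (trans (sym (∑-conv (term q) (term (- q)) n)) (∑-conv-term q n))))


    ½^-nonNeg : ∀ n → 0ℚ ≤ ½ ^ n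
    ½^-nonNeg zero    = nonNegative⁻¹ 1ℚ
    ½^-nonNeg (suc n) = *-nonNeg (nonNegative⁻¹ ½) (½^-nonNeg n)

    ½^≤1 : ∀ n → ½ ^ n ≤ 1ℚ
    ½^≤1 zero    = ≤-refl
    ½^≤1 (suc n) = *-mono (nonNegative⁻¹ ½) ½≤1 (½^-nonNeg n) (½^≤1 n)
      where
      ½≤1 : ½ ≤ 1ℚ
      ½≤1 = ≤ᵇ⇒≤ _

    n½^≤1 : ∀ n → ι n * ½ ^ n ≤ 1ℚ
    n½^≤1 zero    = nonNegative⁻¹ 1ℚ
    n½^≤1 (suc n) = ≡≤ (trans (cong (_* (½ * ½ ^ n)) (ι-+ 1 n))
        (solve 2 (λ i p → (con 1ℚ :+ i) :* (con ½ :* p) := con ½ :* (p :+ i :* p)) refl (ι n) (½ ^ n)))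
      (*-monoˡ-≤-nonNeg ½ (+-mono-≤ (½^≤1 n) (n½^≤1 n)))

    h^≡ : ∀ n → h ^ n ≡ ½ ^ n * ½ ^ n
    h^≡ zero    = refl
    h^≡ (suc n) = trans (cong (h *_) (h^≡ n))
      (solve 1 (λ p → con h :* (p :* p) := (con ½ :* p) :* (con ½ :* p)) refl (½ ^ n))

    h^-nonNeg : ∀ n → 0ℚ ≤ h ^ n
    h^-nonNeg n = subst (0ℚ ≤_) (sym (h^≡ n)) (*-nonNeg (½^-nonNeg n) (½^-nonNeg n))

    nnh^≤1 : ∀ n → (ι n * ι n) * h ^ n ≤ 1ℚ
    nnh^≤1 n = ≡≤ (trans (cong ((ι n * ι n) *_) (h^≡ n))
        (solve 2 (λ i p → (i :* i) :* (p :* p) := (i :* p) :* (i :* p)) refl (ι n) (½ ^ n)))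
      (*-mono 0≤ (n½^≤1 n) 0≤ (n½^≤1 n))
      where 0≤ = *-nonNeg (ι-nonNeg n) (½^-nonNeg n)

    small : ∀ D ε → 0ℚ ≤ D → 0ℚ < ε → Eventually (λ n → D * (ι n * h ^ n) ≤ ε)
    small D ε 0≤D 0<ε = proj₁ arch , λ n N≤n →
      ≤-trans (*-monoʳ-≤-nonNeg (ι n * h ^ n) {{nonNegative (*-nonNeg (ι-nonNeg n) (h^-nonNeg n))}} (D≤ n N≤n))
      (≡≤ (solve 3 (λ e i p → (e :* i) :* (i :* p) := e :* ((i :* i) :* p)) refl ε (ι n) (h ^ n))
      (subst (ε * ((ι n * ι n) * h ^ n) ≤_) (*-identityʳ ε) (*-monoˡ-≤-nonNeg ε {{nonNegative (<⇒≤ 0<ε)}} (nnh^≤1 n))))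
      where
      D+ε = divide ε (ε + D) 0<ε (+-pos 0<ε 0≤D)
      arch = archimedean (proj₁ D+ε)
      D≤ : ∀ n → proj₁ arch ℕ.≤ n → D ≤ ε * ι n
      D≤ n N≤n = ≡≤ (sym (+-identityˡ D)) (≤-trans (+-monoˡ-≤ D (<⇒≤ 0<ε))
        (≡≤ (sym (proj₂ (proj₂ D+ε))) (*-monoˡ-≤-nonNeg ε {{nonNegative (<⇒≤ 0<ε)}} (≤-trans (proj₂ arch) (ι-mono N≤n)))))

    small′ : ∀ D ε → 0ℚ ≤ D → 0ℚ < ε → Eventually (λ n → D * h ^ n ≤ ε)
    small′ D ε 0≤D 0<ε = mapᵉ (λ n (p , 1≤n) → ≤-trans
        (*-monoˡ-≤-nonNeg D {{nonNegative 0≤D}}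
          (≡≤ (sym (*-identityˡ (h ^ n))) (*-monoʳ-≤-nonNeg (h ^ n) {{nonNegative (h^-nonNeg n)}} (ι-mono 1≤n)))) p)
      (small D ε 0≤D 0<ε ∧ᵉ (1 , λ n 1≤n → 1≤n))

    ^≤! : ∀ B k → suc B ℕ.^ k ℕ.≤ suc B ℕ.^ suc B ℕ.* k !
    ^≤! B zero = ℕ.*-mono-≤ {1} (ℕ.m^n>0 (suc B) (suc B)) ℕ.≤-refl
    ^≤! B (suc k) with k ℕ.≤? B
    ... | yes k≤B = ℕ.≤-trans (ℕ.≤-reflexive (sym (ℕ.*-identityʳ (suc B ℕ.^ suc k))))
            (ℕ.*-mono-≤ (ℕ.^-monoʳ-≤ (suc B) (ℕ.s≤s k≤B)) (ℕ.>-nonZero⁻¹ (suc k !) {{suc k !≢0}}))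
    ... | no k≰B = ℕ.≤-trans (ℕ.*-mono-≤ (ℕ.≤-trans (ℕ.≰⇒> k≰B) (ℕ.n≤1+n k)) (^≤! B k))
            (ℕ.≤-reflexive (ℕ-solve (suc k) (suc B ℕ.^ suc B) (k !)))
      where
      ℕ-solve : ∀ a b c → a ℕ.* (b ℕ.* c) ≡ b ℕ.* (a ℕ.* c)
      ℕ-solve a b c = trans (sym (ℕ.*-assoc a b c)) (trans (cong (ℕ._* c) (ℕ.*-comm a b)) (ℕ.*-assoc b a c))

    ∣^∣≤ : ∀ q {b} → ∣ q ∣ ≤ b → ∀ k → ∣ q ^ k ∣ ≤ b ^ k
    ∣^∣≤ q p zero    = ≤-refl
    ∣^∣≤ q p (suc k) = ∣*∣-mono q (q ^ k) p (∣^∣≤ q p k)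

    1/!-nonNeg : ∀ k → 0ℚ ≤ 1/! k
    1/!-nonNeg k = nonNegative⁻¹ (1/! k) {{normalize-nonNeg 1 (k !) {{k !≢0}}}}

    term-bound : ∀ M → ∃ λ C → 0ℚ < C × (∀ q → ∣ q ∣ ≤ ι (suc M) → ∀ k → ∣ term q k ∣ ≤ C * h ^ k)
    term-bound M = C , C-pos , bound
      where
      M′ B : ℕ
      M′ = suc M
      B  = 4 ℕ.* M′

      C : ℚ
      C = ι (B ℕ.^ B)

      C-pos : 0ℚ < C
      C-pos with B ℕ.^ B | ℕ.m^n>0 B B
      ... | suc n | _ = ι-pos n

      B^h^ : ∀ k → ι (B ℕ.^ k) * h ^ k ≡ ι M′ ^ k
      B^h^ zero    = refl
      B^h^ (suc k) = begin
        ι (B ℕ.* B ℕ.^ k) * (h * h ^ k)                ≡⟨ cong (_* (h * h ^ k)) (ι-* B (B ℕ.^ k)) ⟩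
        ι B * ι (B ℕ.^ k) * (h * h ^ k)                ≡⟨ cong (λ t → t * ι (B ℕ.^ k) * (h * h ^ k)) (ι-* 4 M′) ⟩
        ι 4 * ι M′ * ι (B ℕ.^ k) * (h * h ^ k)
          ≡⟨ solve 3 (λ m b p → con (ι 4) :* m :* b :* (con h :* p) := m :* (b :* p)) refl (ι M′) (ι (B ℕ.^ k)) (h ^ k) ⟩
        ι M′ * (ι (B ℕ.^ k) * h ^ k)                   ≡⟨ cong (ι M′ *_) (B^h^ k) ⟩
        ι M′ * ι M′ ^ k                                ∎
        where open ≡-Reasoning

      bound : ∀ q → ∣ q ∣ ≤ ι M′ → ∀ k → ∣ term q k ∣ ≤ C * h ^ k
      bound q p k = begin
        ∣ 1/! k * q ^ k ∣                   ≤⟨ ∣*∣-mono (1/! k) (q ^ k) (≤-reflexive (0≤p⇒∣p∣≡p (1/!-nonNeg k))) (∣^∣≤ q p k) ⟩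
        1/! k * ι M′ ^ k                    ≡⟨ cong (1/! k *_) (B^h^ k) ⟨
        1/! k * (ι (B ℕ.^ k) * h ^ k)
          ≤⟨ *-mono (1/!-nonNeg k) ≤-refl (*-nonNeg (ι-nonNeg (B ℕ.^ k)) (h^-nonNeg k))
               (*-monoʳ-≤-nonNeg (h ^ k) {{nonNegative (h^-nonNeg k)}} (ι-mono (^≤! (M ℕ.+ 3 ℕ.* M′) k))) ⟩
        1/! k * (ι (B ℕ.^ B ℕ.* k !) * h ^ k) ≡⟨ cong (λ t → 1/! k * (t * h ^ k)) (ι-* (B ℕ.^ B) (k !)) ⟩
        1/! k * (C * ι (k !) * h ^ k)
          ≡⟨ solve 4 (λ f c i p → f :* (c :* i :* p) := (i :* f) :* (c :* p)) refl (1/! k) C (ι (k !)) (h ^ k) ⟩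
        (ι (k !) * 1/! k) * (C * h ^ k)     ≡⟨ cong (_* (C * h ^ k)) (recip (k !) {{k !≢0}}) ⟩
        1ℚ * (C * h ^ k)                    ≡⟨ *-identityˡ (C * h ^ k) ⟩
        C * h ^ k                           ∎
        where open ≤-Reasoning

    module Bounds (M : ℕ) (C : ℚ) (C-pos : 0ℚ < C)
      (term-bound : ∀ q → ∣ q ∣ ≤ ι (suc M) → ∀ k → ∣ term q k ∣ ≤ C * h ^ k) where

      M′ : ℕ
      M′ = suc M

      2C : ℚ
      2C = C + C

      2C-nonNeg : 0ℚ ≤ 2C
      2C-nonNeg = <⇒≤ (+-pos C-pos (<⇒≤ C-pos))

      tail-+ : ∀ a → (∀ k → ∣ a k ∣ ≤ C * h ^ k) → ∀ n d →
        ∣ ∑ (d ℕ.+ n) a - ∑ n a ∣ ≤ 2C * h ^ n - 2C * h ^ (d ℕ.+ n)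
      tail-+ a p n zero = ≤-reflexive (trans (cong ∣_∣ (+-inverseʳ (∑ n a))) (sym (+-inverseʳ (2C * h ^ n))))
      tail-+ a p n (suc d) = begin
        ∣ ∑ m a + a m - ∑ n a ∣
          ≡⟨ cong ∣_∣ (solve 3 (λ x y z → x :+ y :- z := (x :- z) :+ y) refl (∑ m a) (a m) (∑ n a)) ⟩
        ∣ (∑ m a - ∑ n a) + a m ∣               ≤⟨ ∣+∣-mono (∑ m a - ∑ n a) (a m) (tail-+ a p n d) (p m) ⟩
        2C * h ^ n - 2C * h ^ m + C * h ^ m
          ≡⟨ +-identityʳ _ ⟨
        2C * h ^ n - 2C * h ^ m + C * h ^ m + 0ℚ
          ≤⟨ +-monoʳ-≤ (2C * h ^ n - 2C * h ^ m + C * h ^ m)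
               (*-nonNeg (nonNegative⁻¹ ½) (*-nonNeg (<⇒≤ C-pos) (h^-nonNeg m))) ⟩
        2C * h ^ n - 2C * h ^ m + C * h ^ m + ½ * (C * h ^ m)
          ≡⟨ solve 3 (λ c x y → (c :+ c) :* x :- (c :+ c) :* y :+ c :* y :+ con ½ :* (c :* y)
               := (c :+ c) :* x :- (c :+ c) :* (con h :* y)) refl C (h ^ n) (h ^ m) ⟩
        2C * h ^ n - 2C * (h * h ^ m)           ∎
        where
        open ≤-Reasoning
        m = d ℕ.+ n

      tail : ∀ a → (∀ k → ∣ a k ∣ ≤ C * h ^ k) → ∀ {m n} → n ℕ.≤ m → ∣ ∑ m a - ∑ n a ∣ ≤ 2C * h ^ n
      tail a p {m} {n} n≤m = begin
        ∣ ∑ m a - ∑ n a ∣                       ≡⟨ cong (λ t → ∣ ∑ t a - ∑ n a ∣) (ℕ.m∸n+n≡m n≤m) ⟨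
        ∣ ∑ (m ∸ n ℕ.+ n) a - ∑ n a ∣           ≤⟨ tail-+ a p n (m ∸ n) ⟩
        2C * h ^ n - 2C * h ^ (m ∸ n ℕ.+ n)     ≤⟨ +-monoʳ-≤ (2C * h ^ n) (neg-antimono-≤ (*-nonNeg 2C-nonNeg (h^-nonNeg (m ∸ n ℕ.+ n)))) ⟩
        2C * h ^ n + 0ℚ                         ≡⟨ +-identityʳ (2C * h ^ n) ⟩
        2C * h ^ n                              ∎
        where open ≤-Reasoning

      ∑-bound : ∀ q → ∣ q ∣ ≤ ι M′ → ∀ n → ∣ ∑ n (term q) ∣ ≤ 2C
      ∑-bound q p n = subst₂ _≤_ (cong ∣_∣ (+-identityʳ (∑ n (term q)))) (*-identityʳ 2C)
        (tail (term q) (term-bound q p) {n} ℕ.z≤n)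

      uniformly-cauchy : ∀ ε → 0ℚ < ε → ∃ λ N → ∀ m n → N ℕ.≤ m → N ℕ.≤ n →
        ∀ q → ∣ q ∣ ≤ ι M′ → ∣ ∑ m (term q) - ∑ n (term q) ∣ ≤ ε
      uniformly-cauchy ε 0<ε = proj₁ eventually , go
        where
        eventually : Eventually (λ n → 2C * h ^ n ≤ ε)
        eventually = small′ 2C ε 2C-nonNeg 0<ε
        N = proj₁ eventually
        f = proj₂ eventually
        go : ∀ m n → N ℕ.≤ m → N ℕ.≤ n → ∀ q → ∣ q ∣ ≤ ι M′ → ∣ ∑ m (term q) - ∑ n (term q) ∣ ≤ ε
        go m n N≤m N≤n q p = [_,_]′
          (λ n≤m → ≤-trans (tail (term q) (term-bound q p) n≤m) (f n N≤n))
          (λ m≤n → ≡≤ (∣-∣-sym (∑ m (term q)) (∑ n (term q)))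
                (≤-trans (tail (term q) (term-bound q p) m≤n) (f m N≤m)))
          (ℕ.≤-total n m)

      conv-bound : ∀ D n a e c → (∀ k → ∣ a k ∣ ≤ c * h ^ k) → (∀ k → k ℕ.≤ n → ∣ e k ∣ ≤ D * h ^ k) →
        ∣ conv a e n ∣ ≤ ι (suc n) * (c * D) * h ^ n
      conv-bound D zero a e c p r = ≤-trans (∣*∣-mono (a 0) (e 0) (p 0) (r 0 ℕ.z≤n))
        (≤-reflexive (solve 2 (λ c d → (c :* con 1ℚ) :* (d :* con 1ℚ) := con (ι 1) :* (c :* d) :* con 1ℚ) refl c D))
      conv-bound D (suc n) a e c p r = begin
        ∣ a 0 * e (suc n) + conv (a ∘ suc) e n ∣
          ≤⟨ ∣+∣-mono (a 0 * e (suc n)) (conv (a ∘ suc) e n)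
               (∣*∣-mono (a 0) (e (suc n)) (p 0) (r (suc n) ℕ.≤-refl))
               (conv-bound D n (a ∘ suc) e (c * h)
                 (λ k → subst (∣ a (suc k) ∣ ≤_) (sym (*-assoc c h (h ^ k))) (p (suc k)))
                 (λ k k≤n → r k (ℕ.≤-trans k≤n (ℕ.n≤1+n n)))) ⟩
        (c * 1ℚ) * (D * (h * h ^ n)) + ι (suc n) * (c * h * D) * h ^ n
          ≡⟨ solve 4 (λ c d x i → (c :* con 1ℚ) :* (d :* (con h :* x)) :+ i :* (c :* con h :* d) :* x
               := (con (ι 1) :+ i) :* (c :* d) :* (con h :* x)) refl c D (h ^ n) (ι (suc n)) ⟩
        (ι 1 + ι (suc n)) * (c * D) * (h * h ^ n)
          ≡⟨ cong (λ t → t * (c * D) * (h * h ^ n)) (ι-+ 1 (suc n)) ⟨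
        ι (2 ℕ.+ n) * (c * D) * (h * h ^ n) ∎
        where open ≤-Reasoning

      product-bound : ∀ q → ∣ q ∣ ≤ ι M′ → ∀ n →
        ∣ ∑ (suc n) (term q) * ∑ (suc n) (term (- q)) - 1ℚ ∣ ≤ C * 2C * (ι (suc n) * h ^ suc n)
      product-bound q p n = begin
        ∣ ∑ (suc n) (term q) * ∑ (suc n) (term (- q)) - 1ℚ ∣   ≡⟨ cong ∣_∣ (product-error q n) ⟩
        ∣ conv (term q) e n ∣
          ≤⟨ conv-bound (2C * h) n (term q) e C (term-bound q p) (λ k k≤n →
               subst (∣ e k ∣ ≤_) (sym (*-assoc 2C h (h ^ k)))
                 (tail (term (- q)) (term-bound (- q) (≡≤ (∣-p∣≡∣p∣ q) p)) (ℕ.s≤s k≤n))) ⟩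
        ι (suc n) * (C * (2C * h)) * h ^ n
          ≡⟨ solve 4 (λ i c d x → i :* (c :* (d :* con h)) :* x := c :* d :* (i :* (con h :* x))) refl (ι (suc n)) C 2C (h ^ n) ⟩
        C * 2C * (ι (suc n) * h ^ suc n) ∎
        where
        open ≤-Reasoning
        e : ℕ → ℚ
        e k = ∑ (suc n) (term (- q)) - ∑ (suc k) (term (- q))

      apart : ∃ λ δ → 0ℚ < δ × Eventually (λ n → ∀ q → ∣ q ∣ ≤ ι M′ → δ ≤ ∣ ∑ n (term q) ∣)
      apart = proj₁ η , proj₁ (proj₂ η) , mapᵉ step
          (small (C * 2C) ½ (*-nonNeg (<⇒≤ C-pos) 2C-nonNeg) (positive⁻¹ ½) ∧ᵉ (1 , λ n 1≤n → 1≤n))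
        where
        2C-pos : 0ℚ < 2C
        2C-pos = +-pos C-pos (<⇒≤ C-pos)
        η = divide 2C ½ 2C-pos (positive⁻¹ ½)
        step : ∀ n → C * 2C * (ι n * h ^ n) ≤ ½ × 1 ℕ.≤ n → ∀ q → ∣ q ∣ ≤ ι M′ → proj₁ η ≤ ∣ ∑ n (term q) ∣
        step (suc n) (s , _) q p = *-cancelˡ-≤-pos 2C {{positive 2C-pos}} (begin
          2C * proj₁ η              ≡⟨ proj₂ (proj₂ η) ⟩
          ½                         ≡⟨⟩
          1ℚ - ½                    ≤⟨ +-monoʳ-≤ 1ℚ (neg-antimono-≤ (≤-trans (product-bound q p n) s)) ⟩
          1ℚ - ∣ P * Q - 1ℚ ∣       ≤⟨ +-monoˡ-≤ (- ∣ P * Q - 1ℚ ∣) (∣∣-shift 1ℚ (P * Q) (≤-reflexive (∣-∣-sym 1ℚ (P * Q))) ≤-refl) ⟩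
          ∣ P * Q - 1ℚ ∣ + ∣ P * Q ∣ - ∣ P * Q - 1ℚ ∣
            ≡⟨ solve 2 (λ x y → x :+ y :- x := y) refl ∣ P * Q - 1ℚ ∣ ∣ P * Q ∣ ⟩
          ∣ P * Q ∣                 ≤⟨ ∣*∣-mono P Q ≤-refl (∑-bound (- q) (≡≤ (∣-p∣≡∣p∣ q) p) (suc n)) ⟩
          ∣ P ∣ * 2C                ≡⟨ *-comm ∣ P ∣ 2C ⟩
          2C * ∣ P ∣                ∎)
          where
          open ≤-Reasoning
          P = ∑ (suc n) (term q)
          Q = ∑ (suc n) (term (- q))

  ∑-uniformly-cauchy : ∀ M ε → 0ℚ < ε → ∃ λ N → ∀ m n → N ℕ.≤ m → N ℕ.≤ n →
    ∀ q → ∣ q ∣ ≤ ι (suc M) → ∣ ∑ m (term q) - ∑ n (term q) ∣ ≤ ε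
  ∑-uniformly-cauchy M = Bounds.uniformly-cauchy M (proj₁ b) (proj₁ (proj₂ b)) (proj₂ (proj₂ b))
    where b = term-bound M

  ∑-apart : ∀ M → ∃ λ δ → 0ℚ < δ × Eventually (λ n → ∀ q → ∣ q ∣ ≤ ι (suc M) → δ ≤ ∣ ∑ n (term q) ∣)
  ∑-apart M = Bounds.apart M (proj₁ b) (proj₁ (proj₂ b)) (proj₂ (proj₂ b))
    where b = term-bound M

open RationalLemmas
open ExponentialBounds using (∑-uniformly-cauchy; ∑-apart)

-- Cauchy sequences of rationals, identified up to _≈_.
record ℝ : Set where
  no-eta-equality
  field
    seq    : ℕ → ℚ
    cauchy : IsCauchy seq

open ℝ public

infix 4 _≈_ _<_

record _≈_ (x y : ℝ) : Set where
  constructor mk≈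
  field
    close : ∀ ε → 0ℚ ℚ.< ε → Eventually (λ n → ℚ.∣ seq x n ℚ.- seq y n ∣ ℚ.≤ ε)

open _≈_ public

record _<_ (x y : ℝ) : Set where
  constructor mk<
  field
    gap : ∃ λ δ → 0ℚ ℚ.< δ × Eventually (λ n → seq x n ℚ.+ δ ℚ.≤ seq y n)

open _<_ public

module Closeness where

  Close : (ℕ → ℚ) → (ℕ → ℚ) → Set
  Close u v = ∀ ε → 0ℚ ℚ.< ε →
    ∃ λ N → ∀ m n → N ℕ.≤ m → N ℕ.≤ n → ℚ.∣ u m ℚ.- v n ∣ ℚ.≤ ε

  ≈⇒close : ∀ {x y} → x ≈ y → Close (seq x) (seq y)
  ≈⇒close {x} {y} x≈y ε p = proj₁ c ℕ.⊔ proj₁ e , λ m n N≤m N≤n →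
    ∣-∣-triangle½ (seq x m) (seq x n) (seq y n)
      (proj₂ c m n (ℕ.≤-trans (ℕ.m≤m⊔n _ _) N≤m) (ℕ.≤-trans (ℕ.m≤m⊔n _ _) N≤n))
      (proj₂ e n (ℕ.≤-trans (ℕ.m≤n⊔m (proj₁ c) (proj₁ e)) N≤n))
    where
    c = cauchy x (½ ℚ.* ε) (half-pos p)
    e = close x≈y (½ ℚ.* ε) (half-pos p)

  close⇒≈ : ∀ {x y} → Close (seq x) (seq y) → x ≈ y
  close⇒≈ c = mk≈ λ ε p → proj₁ (c ε p) , λ n N≤n → proj₂ (c ε p) n n N≤n N≤n

  Close-+ : ∀ u v u′ v′ → Close u u′ → Close v v′ → Close (λ n → u n ℚ.+ v n) (λ n → u′ n ℚ.+ v′ n)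
  Close-+ u v u′ v′ c d ε p = proj₁ cε ℕ.⊔ proj₁ dε , λ m n N≤m N≤n →
    +-close (u m) (v m) (u′ n) (v′ n)
      (proj₂ cε m n (ℕ.≤-trans (ℕ.m≤m⊔n _ _) N≤m) (ℕ.≤-trans (ℕ.m≤m⊔n _ _) N≤n))
      (proj₂ dε m n (ℕ.≤-trans (ℕ.m≤n⊔m (proj₁ cε) _) N≤m) (ℕ.≤-trans (ℕ.m≤n⊔m (proj₁ cε) _) N≤n))
    where
    cε = c (½ ℚ.* ε) (half-pos p)
    dε = d (½ ℚ.* ε) (half-pos p)

  Close-* : ∀ u v u′ v′ → IsCauchy u → IsCauchy v′ → Close u u′ → Close v v′ →
    Close (λ n → u n ℚ.* v n) (λ n → u′ n ℚ.* v′ n)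
  Close-* u v u′ v′ cu cv′ c d ε p = proj₁ cε ℕ.⊔ proj₁ dε , λ m n N≤m N≤n →
    *-close (u m) (v m) (u′ n) (v′ n)
      (≡≤ (sym (ℚ.+-identityʳ ℚ.∣ u m ∣)) (ℚ.+-mono-≤ (proj₂ bu m) (ι-nonNeg (suc (proj₁ bv)))))
      (≡≤ (sym (ℚ.+-identityˡ ℚ.∣ v′ n ∣)) (ℚ.+-mono-≤ (ι-nonNeg (suc (proj₁ bu))) (proj₂ bv n)))
      (proj₂ (proj₂ δ))
      (proj₂ cε m n (ℕ.≤-trans (ℕ.m≤m⊔n _ _) N≤m) (ℕ.≤-trans (ℕ.m≤m⊔n _ _) N≤n))
      (proj₂ dε m n (ℕ.≤-trans (ℕ.m≤n⊔m (proj₁ cε) _) N≤m) (ℕ.≤-trans (ℕ.m≤n⊔m (proj₁ cε) _) N≤n))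
    where
    bu = bounded u cu
    bv = bounded v′ cv′
    B  = ι (suc (proj₁ bu)) ℚ.+ ι (suc (proj₁ bv))
    δ  = divide B (½ ℚ.* ε) (+-pos (ι-pos (proj₁ bu)) (ι-nonNeg (suc (proj₁ bv)))) (half-pos p)
    cε = c (proj₁ δ) (proj₁ (proj₂ δ))
    dε = d (proj₁ δ) (proj₁ (proj₂ δ))

  Close-neg : ∀ u u′ → Close u u′ → Close (λ n → ℚ.- u n) (λ n → ℚ.- u′ n)
  Close-neg u u′ c ε p = proj₁ (c ε p) , λ m n N≤m N≤n → neg-close (u m) (u′ n) (proj₂ (c ε p) m n N≤m N≤n)

  Close-abs : ∀ u u′ → Close u u′ → Close (λ n → ℚ.∣ u n ∣) (λ n → ℚ.∣ u′ n ∣)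
  Close-abs u u′ c ε p = proj₁ (c ε p) , λ m n N≤m N≤n →
    ℚ.≤-trans (∣∣-lipschitz (u m) (u′ n)) (proj₂ (c ε p) m n N≤m N≤n)

open Closeness

fromℚ : ℚ → ℝ
seq    (fromℚ q) _   = q
cauchy (fromℚ q) ε p = 0 , λ _ _ _ _ → ∣-∣-refl {q} refl p

fromℕ : ℕ → ℝ
fromℕ n = fromℚ (+ n ℚ./ 1)

0ℝ 1ℝ : ℝ
0ℝ = fromℚ 0ℚ
1ℝ = fromℚ 1ℚ

infixl 6 _+_ _-_
infixl 7 _*_
infix  8 -_

_+_ _*_ : ℝ → ℝ → ℝ
seq    (x + y) n = seq x n ℚ.+ seq y n
cauchy (x + y)   = Close-+ (seq x) (seq y) (seq x) (seq y) (cauchy x) (cauchy y)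
seq    (x * y) n = seq x n ℚ.* seq y n
cauchy (x * y)   = Close-* (seq x) (seq y) (seq x) (seq y) (cauchy x) (cauchy y) (cauchy x) (cauchy y)

-_ : ℝ → ℝ
seq    (- x) n = ℚ.- seq x n
cauchy (- x)   = Close-neg (seq x) (seq x) (cauchy x)

_-_ : ℝ → ℝ → ℝ
x - y = x + (- y)

∣_∣ : ℝ → ℝ
seq    ∣ x ∣ n = ℚ.∣ seq x n ∣
cauchy ∣ x ∣   = Close-abs (seq x) (seq x) (cauchy x)

pointwise : ∀ {x y} → (∀ n → seq x n ≡ seq y n) → x ≈ y
pointwise h = mk≈ λ ε p → 0 , λ n _ → ∣-∣-refl (h n) p

≈-refl : ∀ {x} → x ≈ x
≈-refl = pointwise (λ _ → refl)

≈-sym : ∀ {x y} → x ≈ y → y ≈ x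
≈-sym {x} {y} e = mk≈ λ ε p → mapᵉ (λ n → ≡≤ (∣-∣-sym (seq y n) (seq x n))) (close e ε p)

≈-trans : ∀ {x y z} → x ≈ y → y ≈ z → x ≈ z
≈-trans {x} {y} {z} e f = mk≈ λ ε p →
  mapᵉ (λ n (a , b) → ∣-∣-triangle½ (seq x n) (seq y n) (seq z n) a b)
    (close e (½ ℚ.* ε) (half-pos p) ∧ᵉ close f (½ ℚ.* ε) (half-pos p))

+-cong : ∀ {x y u v} → x ≈ y → u ≈ v → x + u ≈ y + v
+-cong {x} {y} {u} {v} e f = close⇒≈ (Close-+ (seq x) (seq u) (seq y) (seq v) (≈⇒close e) (≈⇒close f))

*-cong : ∀ {x y u v} → x ≈ y → u ≈ v → x * u ≈ y * v
*-cong {x} {y} {u} {v} e f = close⇒≈ (Close-* (seq x) (seq u) (seq y) (seq v) (cauchy x) (cauchy v) (≈⇒close e) (≈⇒close f))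

-‿cong : ∀ {x y} → x ≈ y → - x ≈ - y
-‿cong {x} {y} e = close⇒≈ (Close-neg (seq x) (seq y) (≈⇒close e))

∣∣-cong : ∀ {x y} → x ≈ y → ∣ x ∣ ≈ ∣ y ∣
∣∣-cong {x} {y} e = close⇒≈ (Close-abs (seq x) (seq y) (≈⇒close e))

ℝ-commutativeRing : CommutativeRing 0ℓ 0ℓ
ℝ-commutativeRing = record
  { Carrier = ℝ ; _≈_ = _≈_ ; _+_ = _+_ ; _*_ = _*_ ; -_ = -_ ; 0# = 0ℝ ; 1# = 1ℝ
  ; isCommutativeRing = record
    { isRing = record
      { +-isAbelianGroup = record
        { isGroup = record
          { isMonoid = record
            { isSemigroup = record
              { isMagma = record
                { isEquivalence = record { refl = ≈-refl ; sym = ≈-sym ; trans = ≈-trans }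
                ; ∙-cong = +-cong }
              ; assoc = λ x y z → pointwise λ n → ℚ.+-assoc (seq x n) (seq y n) (seq z n) }
            ; identity = (λ x → pointwise λ n → ℚ.+-identityˡ (seq x n))
                       , (λ x → pointwise λ n → ℚ.+-identityʳ (seq x n)) }
          ; inverse = (λ x → pointwise λ n → ℚ.+-inverseˡ (seq x n))
                    , (λ x → pointwise λ n → ℚ.+-inverseʳ (seq x n))
          ; ⁻¹-cong = -‿cong }
        ; comm = λ x y → pointwise λ n → ℚ.+-comm (seq x n) (seq y n) }
      ; *-cong = *-cong
      ; *-assoc = λ x y z → pointwise λ n → ℚ.*-assoc (seq x n) (seq y n) (seq z n)
      ; *-identity = (λ x → pointwise λ n → ℚ.*-identityˡ (seq x n))
                   , (λ x → pointwise λ n → ℚ.*-identityʳ (seq x n))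
      ; distrib = (λ x y z → pointwise λ n → ℚ.*-distribˡ-+ (seq x n) (seq y n) (seq z n))
                , (λ x y z → pointwise λ n → ℚ.*-distribʳ-+ (seq x n) (seq y n) (seq z n)) }
    ; *-comm = λ x y → pointwise λ n → ℚ.*-comm (seq x n) (seq y n) } }

open import Algebra.Definitions.RawSemiring (CommutativeSemiring.rawSemiring (CommutativeRing.commutativeSemiring ℝ-commutativeRing)) public using (_^_)

∑< ∏< : ℕ → (ℕ → ℝ) → ℝ
∑< = fold< _+_ 0ℝ
∏< = fold< _*_ 1ℝ

NonZero : ℝ → Set
NonZero x = 0ℝ < ∣ x ∣

inverse : ∀ x → NonZero x → ℝ
seq    (inverse x x≢0) n   = recip₀ (seq x n)
cauchy (inverse x x≢0) ε p =
  let c = cauchy x (δ ℚ.* δ ℚ.* ε) (*-pos (*-pos 0<δ 0<δ) p)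
  in proj₁ c ℕ.⊔ proj₁ away , λ m n N≤m N≤n →
    recip₀-close (seq x m) (seq x n) 0<δ
      (apart m (ℕ.≤-trans (ℕ.m≤n⊔m (proj₁ c) _) N≤m))
      (apart n (ℕ.≤-trans (ℕ.m≤n⊔m (proj₁ c) _) N≤n))
      (proj₂ c m n (ℕ.≤-trans (ℕ.m≤m⊔n _ _) N≤m) (ℕ.≤-trans (ℕ.m≤m⊔n _ _) N≤n))
  where
  δ     = proj₁ (gap x≢0)
  0<δ   = proj₁ (proj₂ (gap x≢0))
  away  = proj₂ (proj₂ (gap x≢0))
  apart : ∀ n → proj₁ away ℕ.≤ n → δ ℚ.≤ ℚ.∣ seq x n ∣
  apart n N≤n = ≡≤ (sym (ℚ.+-identityˡ δ)) (proj₂ away n N≤n)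

*-inverseʳ : ∀ x (x≢0 : NonZero x) → x * inverse x x≢0 ≈ 1ℝ
*-inverseʳ x x≢0 = mk≈ λ ε p → mapᵉ
  (λ n δ≤ → ∣-∣-refl (recip₀-inverse {seq x n} (proj₁ (proj₂ (gap x≢0)))
    (≡≤ (sym (ℚ.+-identityˡ (proj₁ (gap x≢0)))) δ≤)) p)
  (proj₂ (proj₂ (gap x≢0)))

infix 4 _⟶_

_⟶_ : (ℕ → ℝ) → ℝ → Set
f ⟶ L = ∀ ε → 0ℚ ℚ.< ε → Eventually (λ n → ∣ f n - L ∣ < fromℚ ε)

IsCauchySeq : (ℕ → ℝ) → Set
IsCauchySeq f = ∀ ε → 0ℚ ℚ.< ε →
  ∃ λ N → ∀ m n → N ℕ.≤ m → N ℕ.≤ n → ∣ f m - f n ∣ < fromℚ ε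

HasSum : (ℕ → ℝ) → ℝ → Set
HasSum a L = (λ n → ∑< n a) ⟶ L

within : ∀ x y ε → 0ℚ ℚ.< ε → Eventually (λ n → ℚ.∣ seq x n ℚ.- seq y n ∣ ℚ.≤ ½ ℚ.* ε) → ∣ x - y ∣ < fromℚ ε
within x y ε p e = mk< (½ ℚ.* ε , half-pos p , mapᵉ (λ n q →
  ℚ.≤-trans (ℚ.+-monoˡ-≤ (½ ℚ.* ε) q) (ℚ.≤-reflexive (halves ε))) e)

within⁻¹ : ∀ x y ε → ∣ x - y ∣ < fromℚ ε → Eventually (λ n → ℚ.∣ seq x n ℚ.- seq y n ∣ ℚ.≤ ε)
within⁻¹ x y ε l = mapᵉ (λ n q → ≡≤ (sym (ℚ.+-identityʳ _))
  (ℚ.≤-trans (ℚ.+-monoʳ-≤ ℚ.∣ seq x n ℚ.- seq y n ∣ (ℚ.<⇒≤ (proj₁ (proj₂ (gap l))))) q)) (proj₂ (proj₂ (gap l)))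

module Completeness (f : ℕ → ℝ) (c : IsCauchySeq f) where

  index : ℕ → ℕ
  index n = proj₁ (cauchy (f n) (1/suc n) (1/suc-pos n))

  diagonal : ℕ → ℚ
  diagonal n = seq (f n) (index n)

  diagonal-near : ∀ n i → index n ℕ.≤ i → ℚ.∣ diagonal n ℚ.- seq (f n) i ∣ ℚ.≤ 1/suc n
  diagonal-near n i h = proj₂ (cauchy (f n) (1/suc n) (1/suc-pos n)) (index n) i ℕ.≤-refl h

  diagonal-cauchy : IsCauchy diagonal
  diagonal-cauchy ε p = proj₁ s ℕ.⊔ proj₁ d , λ m n N≤m N≤n →
    let w  = within⁻¹ (f m) (f n) ε″ (proj₂ d m n (ℕ.≤-trans (ℕ.m≤n⊔m (proj₁ s) _) N≤m) (ℕ.≤-trans (ℕ.m≤n⊔m (proj₁ s) _) N≤n))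
        i  = index m ℕ.⊔ index n ℕ.⊔ proj₁ w
        m≤ = ℕ.≤-trans (ℕ.m≤m⊔n (index m) (index n)) (ℕ.m≤m⊔n (index m ℕ.⊔ index n) (proj₁ w))
        n≤ = ℕ.≤-trans (ℕ.m≤n⊔m (index m) (index n)) (ℕ.m≤m⊔n (index m ℕ.⊔ index n) (proj₁ w))
    in ∣-∣-triangle½ (diagonal m) (seq (f n) i) (diagonal n)
         (∣-∣-triangle½ (diagonal m) (seq (f m) i) (seq (f n) i)
           (ℚ.≤-trans (diagonal-near m i m≤) (proj₂ s m (ℕ.≤-trans (ℕ.m≤m⊔n _ _) N≤m)))
           (proj₂ w i (ℕ.m≤n⊔m (index m ℕ.⊔ index n) (proj₁ w))))
         (≡≤ (∣-∣-sym (seq (f n) i) (diagonal n))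
           (ℚ.≤-trans (diagonal-near n i n≤) (ℚ.≤-trans (proj₂ s n (ℕ.≤-trans (ℕ.m≤m⊔n _ _) N≤n)) ε″≤)))
    where
    ε′ ε″ : ℚ
    ε′ = ½ ℚ.* ε
    ε″ = ½ ℚ.* ε′
    s = 1/suc-small ε″ (half-pos (half-pos p))
    d = c ε″ (half-pos (half-pos p))
    ε″≤ : ε″ ℚ.≤ ε′
    ε″≤ = ≡≤ (sym (ℚ.+-identityʳ ε″)) (ℚ.≤-trans (ℚ.+-monoʳ-≤ ε″ (ℚ.<⇒≤ (half-pos (half-pos p)))) (ℚ.≤-reflexive (halves ε′)))

  limit : ℝ
  seq    limit = diagonal
  cauchy limit = diagonal-cauchy

  converges : f ⟶ limit
  converges ε p = proj₁ s ℕ.⊔ proj₁ d , λ n N≤n → within (f n) limit ε p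
    (index n ℕ.⊔ proj₁ d , λ i M≤i →
      ∣-∣-triangle½ (seq (f n) i) (diagonal n) (diagonal i)
        (≡≤ (∣-∣-sym (seq (f n) i) (diagonal n))
          (ℚ.≤-trans (diagonal-near n i (ℕ.≤-trans (ℕ.m≤m⊔n _ _) M≤i)) (proj₂ s n (ℕ.≤-trans (ℕ.m≤m⊔n _ _) N≤n))))
        (proj₂ d n i (ℕ.≤-trans (ℕ.m≤n⊔m (proj₁ s) _) N≤n) (ℕ.≤-trans (ℕ.m≤n⊔m (index n) _) M≤i)))
    where
    ε″ = ½ ℚ.* (½ ℚ.* ε)
    s = 1/suc-small ε″ (half-pos (half-pos p))
    d = diagonal-cauchy ε″ (half-pos (half-pos p))

open Completeness public using () renaming (limit to lim; converges to lim-converges)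

1/_! : ℕ → ℝ
1/ k ! = fromℚ ((+ 1 ℚ./ (k !)) {{k !≢0}})

module Exponential (x : ℝ) where

  term : ℕ → ℝ
  term k = 1/ k ! * x ^ k

  private
    module E = ExponentialBounds

    seq-^ : ∀ k i → seq (x ^ k) i ≡ E._^_ (seq x i) k
    seq-^ zero    i = refl
    seq-^ (suc k) i = cong (seq x i ℚ.*_) (seq-^ k i)

    seq-∑ : ∀ n i → seq (∑< n term) i ≡ E.∑ n (E.term (seq x i))
    seq-∑ zero    i = refl
    seq-∑ (suc n) i = cong₂ (λ s t → s ℚ.+ 1/! n ℚ.* t) (seq-∑ n i) (seq-^ n i)

    M : ℕ
    M = proj₁ (bounded (seq x) (cauchy x))

    ∣x∣≤M : ∀ i → ℚ.∣ seq x i ∣ ℚ.≤ ι (suc M)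
    ∣x∣≤M = proj₂ (bounded (seq x) (cauchy x))

  partial-sums-cauchy : IsCauchySeq (λ n → ∑< n term)
  partial-sums-cauchy ε p = proj₁ u , λ m n N≤m N≤n → within (∑< m term) (∑< n term) ε p
    (0 , λ i _ → ≡≤ (cong₂ (λ s t → ℚ.∣ s ℚ.- t ∣) (seq-∑ m i) (seq-∑ n i))
      (proj₂ u m n N≤m N≤n (seq x i) (∣x∣≤M i)))
    where u = ∑-uniformly-cauchy M (½ ℚ.* ε) (half-pos p)

  exp : ℝ
  exp = lim (λ n → ∑< n term) partial-sums-cauchy

  exp-hasSum : HasSum term exp
  exp-hasSum = lim-converges (λ n → ∑< n term) partial-sums-cauchy

  exp-nonZero : NonZero exp
  exp-nonZero = mk< (proj₁ a , proj₁ (proj₂ a) , mapᵉ (λ n h →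
      ≡≤ (ℚ.+-identityˡ (proj₁ a))
        (ℚ.≤-trans (h (seq x (index n)) (∣x∣≤M (index n))) (ℚ.≤-reflexive (cong ℚ.∣_∣ (sym (seq-∑ n (index n)))))))
      (proj₂ (proj₂ a)))
    where
    a = ∑-apart M
    open Completeness (λ n → ∑< n term) partial-sums-cauchy using (index)

open Exponential public using (exp; exp-hasSum; exp-nonZero)

-- Coefficients in increasing degree; trailing zeros are immaterial up to _≋_.
Polynomial : Set
Polynomial = List ℝ

coeff : Polynomial → ℕ → ℝ
coeff []      _       = 0ℝ
coeff (a ∷ p) zero    = a
coeff (a ∷ p) (suc i) = coeff p i

infix 4 _≋_

_≋_ : Polynomial → Polynomial → Set
p ≋ q = ∀ i → coeff p i ≈ coeff q i

infixl 6 _⊕_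
infixr 7 _·_

_⊕_ : Polynomial → Polynomial → Polynomial
[]      ⊕ q       = q
(a ∷ p) ⊕ []      = a ∷ p
(a ∷ p) ⊕ (b ∷ q) = (a + b) ∷ (p ⊕ q)

_·_ : ℝ → Polynomial → Polynomial
c · p = map (c *_) p

Operator : Set
Operator = Polynomial → Polynomial

X : Operator
X p = 0ℝ ∷ p

-- Leibniz: (a + x p)′ = p + x p′
D : Operator
D []      = []
D (a ∷ p) = p ⊕ X (D p)

infixl 6 _⊞_ _⊟_
infixr 7 _⊙_
infixr 10 _↑_

_⊞_ _⊟_ : Operator → Operator → Operator
(A ⊞ B) p = A p ⊕ B p
(A ⊟ B) p = A p ⊕ (- 1ℝ) · B p

_⊙_ : ℝ → Operator → Operator
(c ⊙ A) p = c · A p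

_↑_ : Operator → ℕ → Operator
A ↑ n = fold< _∘′_ id n (λ _ → A)

-- The factor of smallest index is leftmost, hence applied last.
∏ᵒ : ℕ → (ℕ → Operator) → Operator
∏ᵒ = fold< _∘′_ id

∑ᵒ : ℕ → (ℕ → Operator) → Operator
∑ᵒ = fold< _⊞_ (λ _ → [])

-- S k plays the role of S_λ^{(r,s)}(n,k), for 0 ≤ k ≤ n s; other values of S are irrelevant.
IsDegenerateStirling₂ : ℝ → ℕ → ℕ → ℕ → (ℕ → ℝ) → Set
IsDegenerateStirling₂ lam r s n S = ∀ p →
  ∏ᵒ n (λ k → (X ↑ r ∘′ D ↑ s) ⊟ (fromℕ k * lam) ⊙ X ↑ (r ∸ s)) p
  ≋ (X ↑ (n ℕ.* (r ∸ s)) ∘′ ∑ᵒ (suc (n ℕ.* s)) (λ k → S k ⊙ (X ↑ k ∘′ D ↑ k))) p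

bellPolynomial : ℕ → ℕ → (ℕ → ℝ) → ℝ → ℝ
bellPolynomial s n S x = ∑< (suc (n ℕ.* s)) (λ k → S k * x ^ k)

falling : ℝ → ℕ → ℝ
falling y m = ∏< m (λ i → y - fromℕ i)

∏[1⋯_] : ℕ → (ℕ → ℝ) → ℝ
∏[1⋯ n ] f = ∏< n (f ∘′ suc)

e : ℝ
e = exp 1ℝ

1/e : ℝ
1/e = inverse e (exp-nonZero 1ℝ)

1/exp : ℝ → ℝ
1/exp x = inverse (exp x) (exp-nonZero x)

-- Both sides of the operator identity map xᵐ to a scalar multiple of xᵐ⁺ⁿ⁽ʳ⁻ˢ⁾. Comparing the scalars gives
--   ∏_{j=1}^n [(m + (j-1)(r-s))_s - (n-j) λ] = ∑_k S_λ^{(r,s)}(n,k) (m)_k,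
-- and ∑_m (m)_k x^m / m! = x^k exp x, so the series has sum φ(x) exp x.

module Submission where

open import Defs
open import Algebra.Bundles using (CommutativeRing)
import Algebra.Properties.Ring as RingProperties
import Algebra.Solver.Ring.NaturalCoefficients.Default as RingSolver
open import Data.List.Base using ([]; _∷_)
open import Data.Nat.Base as ℕ using (ℕ; zero; suc; _!; _∸_; z≤n; s≤s)
import Data.Nat.Properties as ℕ
open import Data.Product.Base using (∃; _×_; _,_; proj₁; proj₂)
open import Data.Rational.Base as ℚ using (ℚ; 0ℚ; 1ℚ; ½)
import Data.Rational.Properties as ℚ
open import Data.Rational.Solver using () renaming (module +-*-Solver to ℚ-Solver)
open import Data.Sum.Base using (inj₁; inj₂)
open import Function.Base using (_∘_; _∘′_)
open import Relation.Binary.PropositionalEquality as ≡ using (_≡_; cong; cong₂; subst; subst₂)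
open import Relation.Nullary.Decidable.Core using (yes; no)

open RationalLemmas
open CommutativeRing ℝ-commutativeRing using
  ( ring; setoid; commutativeSemiring; reflexive
  ; +-identityˡ; +-identityʳ; +-assoc; -‿inverseʳ
  ; *-identityˡ; *-identityʳ; *-assoc; distribˡ; distribʳ; zeroˡ; zeroʳ )
open RingProperties ring using (-1*x≈-x)
open RingSolver commutativeSemiring using (solve; _:=_; _:+_; _:*_)
open import Relation.Binary.Reasoning.Setoid setoid
open ℚ-Solver using () renaming (_:=_ to _:=ℚ_; _:+_ to _:+ℚ_; _:-_ to _:-ℚ_; _:*_ to _:*ℚ_)

-- Finite sums and products, factorials, falling factorials.

∑<-cong : ∀ {a b} → (∀ k → a k ≈ b k) → ∀ n → ∑< n a ≈ ∑< n b
∑<-cong h zero    = ≈-refl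
∑<-cong h (suc n) = +-cong (∑<-cong h n) (h n)

∏<-cong : ∀ {a b} → (∀ k → a k ≈ b k) → ∀ n → ∏< n a ≈ ∏< n b
∏<-cong h zero    = ≈-refl
∏<-cong h (suc n) = *-cong (∏<-cong h n) (h n)

∑<-+ : ∀ a b n → ∑< n (λ k → a k + b k) ≈ ∑< n a + ∑< n b
∑<-+ a b zero    = ≈-sym (+-identityʳ 0ℝ)
∑<-+ a b (suc n) = ≈-trans (+-cong (∑<-+ a b n) ≈-refl)
  (solve 4 (λ s t u v → (s :+ t) :+ (u :+ v) := (s :+ u) :+ (t :+ v)) ≈-refl (∑< n a) (∑< n b) (a n) (b n))

∑<-*ˡ : ∀ c a n → ∑< n (λ k → c * a k) ≈ c * ∑< n a
∑<-*ˡ c a zero    = ≈-sym (zeroʳ c)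
∑<-*ˡ c a (suc n) = ≈-trans (+-cong (∑<-*ˡ c a n) ≈-refl) (≈-sym (distribˡ c (∑< n a) (a n)))

∑<-front : ∀ a n → ∑< (suc n) a ≈ a 0 + ∑< n (a ∘ suc)
∑<-front a zero    = ≈-trans (+-identityˡ (a 0)) (≈-sym (+-identityʳ (a 0)))
∑<-front a (suc n) = ≈-trans (+-cong (∑<-front a n) ≈-refl) (+-assoc (a 0) (∑< n (a ∘ suc)) (a (suc n)))

∏<-front : ∀ a n → ∏< (suc n) a ≈ a 0 * ∏< n (a ∘ suc)
∏<-front a zero    = ≈-trans (*-identityˡ (a 0)) (≈-sym (*-identityʳ (a 0)))
∏<-front a (suc n) = ≈-trans (*-cong (∏<-front a n) ≈-refl) (*-assoc (a 0) (∏< n (a ∘ suc)) (a (suc n)))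

fromℕ-suc : ∀ n → fromℕ (suc n) ≈ 1ℝ + fromℕ n
fromℕ-suc n = pointwise λ _ → ι-+ 1 n

fromℕ-suc-minus-suc : ∀ m n → fromℕ (suc m) - fromℕ (suc n) ≈ fromℕ m - fromℕ n
fromℕ-suc-minus-suc m n = pointwise λ _ → ≡.trans (cong₂ ℚ._-_ (ι-+ 1 m) (ι-+ 1 n))
  (ℚ-Solver.solve 3 (λ o x y → (o :+ℚ x) :-ℚ (o :+ℚ y) :=ℚ x :-ℚ y) ≡.refl 1ℚ (ι m) (ι n))

!-inverse : ∀ k → fromℕ (k !) * 1/ k ! ≈ 1ℝ
!-inverse k = pointwise λ _ → recip (k !) {{k ℕ.!≢0}}

-- Inserting `fromℕ (k !) * 1/ k !`, which is 1, completes `fromℕ (suc k)` to `fromℕ (suc k !)`, and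
-- this cancels against `1/ suc k !`.
1/!-suc : ∀ k → 1/ suc k ! * fromℕ (suc k) ≈ 1/ k !
1/!-suc k = begin
  1/ suc k ! * fromℕ (suc k)
    ≈⟨ *-identityʳ _ ⟨
  1/ suc k ! * fromℕ (suc k) * 1ℝ
    ≈⟨ *-cong ≈-refl (!-inverse k) ⟨
  1/ suc k ! * fromℕ (suc k) * (fromℕ (k !) * 1/ k !)
    ≈⟨ solve 4 (λ f i j g → f :* i :* (j :* g) := i :* j :* f :* g) ≈-refl
         (1/ suc k !) (fromℕ (suc k)) (fromℕ (k !)) (1/ k !) ⟩
  fromℕ (suc k) * fromℕ (k !) * 1/ suc k ! * 1/ k !
    ≈⟨ *-cong (*-cong (pointwise λ _ → ι-* (suc k) (k !)) ≈-refl) ≈-refl ⟨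
  fromℕ (suc k !) * 1/ suc k ! * 1/ k !
    ≈⟨ *-cong (!-inverse (suc k)) ≈-refl ⟩
  1ℝ * 1/ k !
    ≈⟨ *-identityˡ _ ⟩
  1/ k ! ∎

-- The first factor splits off, and in each remaining difference both terms drop by one.
falling-suc-suc : ∀ i m → falling (fromℕ (suc i)) (suc m) ≈ fromℕ (suc i) * falling (fromℕ i) m
falling-suc-suc i m = ≈-trans (∏<-front (λ j → fromℕ (suc i) - fromℕ j) m)
  (*-cong (pointwise λ _ → ℚ.+-identityʳ (ι (suc i))) (∏<-cong (fromℕ-suc-minus-suc i) m))

-- One of the factors is `fromℕ i - fromℕ i`; the recursion strips last factors until it is reached.
falling-zero : ∀ {i m} → i ℕ.< m → falling (fromℕ i) m ≈ 0ℝ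
falling-zero {i} {suc m} i<1+m with i ℕ.≟ m
... | yes ≡.refl = ≈-trans (*-cong ≈-refl (-‿inverseʳ (fromℕ i))) (zeroʳ _)
... | no i≢m     = ≈-trans (*-cong (falling-zero (ℕ.≤∧≢⇒< (ℕ.≤-pred i<1+m) i≢m)) ≈-refl) (zeroˡ _)

-- Polynomials and operators

coeff-⊕ : ∀ p q i → coeff (p ⊕ q) i ≈ coeff p i + coeff q i
coeff-⊕ []      q       i       = ≈-sym (+-identityˡ _)
coeff-⊕ (a ∷ p) []      i       = ≈-sym (+-identityʳ _)
coeff-⊕ (a ∷ p) (b ∷ q) zero    = ≈-refl
coeff-⊕ (a ∷ p) (b ∷ q) (suc i) = coeff-⊕ p q i

coeff-· : ∀ c p i → coeff (c · p) i ≈ c * coeff p i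
coeff-· c []      i       = ≈-sym (zeroʳ c)
coeff-· c (a ∷ p) zero    = ≈-refl
coeff-· c (a ∷ p) (suc i) = coeff-· c p i

-- In the Leibniz rule for `a ∷ p`, the summand `p` adds one copy of the coefficient to those coming
-- from `D p`.
coeff-D : ∀ p i → coeff (D p) i ≈ fromℕ (suc i) * coeff p (suc i)
coeff-D []      i       = ≈-sym (zeroʳ _)
coeff-D (a ∷ p) zero    = ≈-trans (coeff-⊕ p (X (D p)) 0)
  (≈-trans (+-identityʳ (coeff p 0)) (≈-sym (*-identityˡ (coeff p 0))))
coeff-D (a ∷ p) (suc i) = begin
  coeff (p ⊕ X (D p)) (suc i)                          ≈⟨ coeff-⊕ p (X (D p)) (suc i) ⟩
  coeff p (suc i) + coeff (D p) i                      ≈⟨ +-cong (≈-sym (*-identityˡ _)) (coeff-D p i) ⟩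
  1ℝ * coeff p (suc i) + fromℕ (suc i) * coeff p (suc i) ≈⟨ distribʳ _ 1ℝ (fromℕ (suc i)) ⟨
  (1ℝ + fromℕ (suc i)) * coeff p (suc i)               ≈⟨ *-cong (fromℕ-suc (suc i)) ≈-refl ⟨
  fromℕ (2 ℕ.+ i) * coeff p (suc i)                    ∎

coeff-X↑-+ : ∀ r p i → coeff ((X ↑ r) p) (i ℕ.+ r) ≡ coeff p i
coeff-X↑-+ zero    p i = cong (coeff p) (ℕ.+-identityʳ i)
coeff-X↑-+ (suc r) p i = ≡.trans (cong (coeff ((X ↑ r) (X p))) (ℕ.+-suc i r)) (coeff-X↑-+ r (X p) (suc i))

coeff-X↑-< : ∀ {r} p {i} → i ℕ.< r → coeff ((X ↑ r) p) i ≡ 0ℝ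
coeff-X↑-< {suc r} p {i} i<1+r with i ℕ.≟ r
-- This coefficient is the constant term of `X p`, which computes to `0ℝ`.
... | yes ≡.refl = coeff-X↑-+ r (X p) 0
... | no i≢r     = coeff-X↑-< (X p) (ℕ.≤∧≢⇒< (ℕ.≤-pred i<1+r) i≢r)

-- `D ↑ suc s` applies one `D` first, so the induction hypothesis is used at `D p`; the new factor
-- enters at the front of the falling factorial.
coeff-D↑ : ∀ s p i → coeff ((D ↑ s) p) i ≈ falling (fromℕ (i ℕ.+ s)) s * coeff p (i ℕ.+ s)
coeff-D↑ zero    p i = ≈-trans (reflexive (cong (coeff p) (≡.sym (ℕ.+-identityʳ i)))) (≈-sym (*-identityˡ _))
coeff-D↑ (suc s) p i rewrite ℕ.+-suc i s = begin
  coeff ((D ↑ s) (D p)) i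
    ≈⟨ coeff-D↑ s (D p) i ⟩
  falling (fromℕ (i ℕ.+ s)) s * coeff (D p) (i ℕ.+ s)
    ≈⟨ *-cong ≈-refl (coeff-D p (i ℕ.+ s)) ⟩
  falling (fromℕ (i ℕ.+ s)) s * (fromℕ (suc (i ℕ.+ s)) * coeff p (suc (i ℕ.+ s)))
    ≈⟨ solve 3 (λ f n c → f :* (n :* c) := n :* f :* c) ≈-refl
         (falling (fromℕ (i ℕ.+ s)) s) (fromℕ (suc (i ℕ.+ s))) (coeff p (suc (i ℕ.+ s))) ⟩
  fromℕ (suc (i ℕ.+ s)) * falling (fromℕ (i ℕ.+ s)) s * coeff p (suc (i ℕ.+ s))
    ≈⟨ *-cong (falling-suc-suc (i ℕ.+ s) s) ≈-refl ⟨
  falling (fromℕ (suc (i ℕ.+ s))) (suc s) * coeff p (suc (i ℕ.+ s)) ∎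

-- Expresses that the operator sends the monomial of degree `i` to `w i` times the monomial of
-- degree `i + d`. Reading this off coefficients of arbitrary polynomials avoids decomposing them
-- into monomials.
record Graded (d : ℕ) (w : ℕ → ℝ) (A : Operator) : Set where
  constructor mkGraded
  field
    coeff-graded : ∀ p i → coeff (A p) (i ℕ.+ d) ≈ w i * coeff p i

open Graded

coeff-XD : ∀ {r s} → s ℕ.≤ r → ∀ p i →
  coeff ((X ↑ r) ((D ↑ s) p)) (i ℕ.+ (r ∸ s)) ≈ falling (fromℕ i) s * coeff p i
coeff-XD {r} {s} s≤r p i with ℕ.≤-<-connex s i
... | inj₁ s≤i = begin
  coeff ((X ↑ r) ((D ↑ s) p)) (i ℕ.+ (r ∸ s))
    ≡⟨ cong (coeff ((X ↑ r) ((D ↑ s) p))) index ⟩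
  coeff ((X ↑ r) ((D ↑ s) p)) (i ∸ s ℕ.+ r)
    ≡⟨ coeff-X↑-+ r ((D ↑ s) p) (i ∸ s) ⟩
  coeff ((D ↑ s) p) (i ∸ s)
    ≈⟨ coeff-D↑ s p (i ∸ s) ⟩
  falling (fromℕ (i ∸ s ℕ.+ s)) s * coeff p (i ∸ s ℕ.+ s)
    ≡⟨ cong (λ j → falling (fromℕ j) s * coeff p j) (ℕ.m∸n+n≡m s≤i) ⟩
  falling (fromℕ i) s * coeff p i ∎
  where
  index : i ℕ.+ (r ∸ s) ≡ i ∸ s ℕ.+ r
  index = ≡.trans (≡.sym (ℕ.+-∸-assoc i s≤r)) (ℕ.+-∸-comm r s≤i)
-- The index now lies below `r`, where multiplication by the power of x leaves only zeros; the
-- falling factorial vanishes as well.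
... | inj₂ i<s = begin
  coeff ((X ↑ r) ((D ↑ s) p)) (i ℕ.+ (r ∸ s))
    ≡⟨ coeff-X↑-< ((D ↑ s) p) (subst (i ℕ.+ (r ∸ s) ℕ.<_) (ℕ.m+[n∸m]≡n s≤r) (ℕ.+-monoˡ-< (r ∸ s) i<s)) ⟩
  0ℝ
    ≈⟨ zeroˡ _ ⟨
  0ℝ * coeff p i
    ≈⟨ *-cong (falling-zero i<s) ≈-refl ⟨
  falling (fromℕ i) s * coeff p i ∎

graded-XD : ∀ {r s} → s ℕ.≤ r → Graded (r ∸ s) (λ i → falling (fromℕ i) s) (X ↑ r ∘′ D ↑ s)
graded-XD s≤r = mkGraded (coeff-XD s≤r)

graded-⊙ : ∀ {d w A} c → Graded d w A → Graded d (λ i → c * w i) (c ⊙ A)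
graded-⊙ {A = A} c g = mkGraded λ p i →
  ≈-trans (coeff-· c (A p) _) (≈-trans (*-cong ≈-refl (coeff-graded g p i)) (≈-sym (*-assoc c _ _)))

graded-⊞ : ∀ {d v w A B} → Graded d v A → Graded d w B → Graded d (λ i → v i + w i) (A ⊞ B)
graded-⊞ {A = A} {B} g h = mkGraded λ p i → ≈-trans (coeff-⊕ (A p) (B p) _)
  (≈-trans (+-cong (coeff-graded g p i) (coeff-graded h p i)) (≈-sym (distribʳ _ _ _)))

graded-cong : ∀ {d v w A} → (∀ i → v i ≈ w i) → Graded d v A → Graded d w A
graded-cong v≈w g = mkGraded λ p i → ≈-trans (coeff-graded g p i) (*-cong (v≈w i) ≈-refl)

graded-⊟ : ∀ {d v w A B} → Graded d v A → Graded d w B → Graded d (λ i → v i - w i) (A ⊟ B)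
-- On every polynomial `A ⊟ B` and `A ⊞ - 1ℝ ⊙ B` compute to the same value, so the coefficient
-- identity carries over.
graded-⊟ {v = v} {w} {A} {B} g h = mkGraded (coeff-graded
  (graded-cong {A = A ⊞ - 1ℝ ⊙ B} (λ i → +-cong ≈-refl (-1*x≈-x (w i))) (graded-⊞ g (graded-⊙ (- 1ℝ) h))))

-- The factor of largest index acts first. Hence the factor of index `n ∸ suc j` meets a degree
-- already raised `j` times by `d`, which pairs decreasing indices with increasing degrees.
graded-∏ᵒ : ∀ {d A} (w : ℕ → ℕ → ℝ) → (∀ k → Graded d (w k) (A k)) → ∀ n →
  Graded (n ℕ.* d) (λ i → ∏< n (λ j → w (n ∸ suc j) (i ℕ.+ j ℕ.* d))) (∏ᵒ n A)
graded-∏ᵒ w g zero = mkGraded λ p i →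
  ≈-trans (reflexive (cong (coeff p) (ℕ.+-identityʳ i))) (≈-sym (*-identityˡ _))
graded-∏ᵒ {d} {A} w g (suc n) = mkGraded λ p i → let W = ∏< n (λ j → w (n ∸ suc j) (i ℕ.+ d ℕ.+ j ℕ.* d)) in begin
  coeff (∏ᵒ n A (A n p)) (i ℕ.+ (d ℕ.+ n ℕ.* d))
    ≡⟨ cong (coeff (∏ᵒ n A (A n p))) (ℕ.+-assoc i d (n ℕ.* d)) ⟨
  coeff (∏ᵒ n A (A n p)) (i ℕ.+ d ℕ.+ n ℕ.* d)
    ≈⟨ coeff-graded (graded-∏ᵒ w g n) (A n p) (i ℕ.+ d) ⟩
  W * coeff (A n p) (i ℕ.+ d)
    ≈⟨ *-cong ≈-refl (coeff-graded (g n) p i) ⟩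
  W * (w n i * coeff p i)
    ≈⟨ solve 3 (λ a b c → a :* (b :* c) := b :* a :* c) ≈-refl W (w n i) (coeff p i) ⟩
  w n i * W * coeff p i
    ≈⟨ *-cong (*-cong (reflexive (cong (w n) (≡.sym (ℕ.+-identityʳ i))))
         (∏<-cong (λ j → reflexive (cong (w (n ∸ suc j)) (ℕ.+-assoc i d (j ℕ.* d)))) n)) ≈-refl ⟩
  w n (i ℕ.+ 0) * ∏< n (λ j → w (n ∸ suc j) (i ℕ.+ suc j ℕ.* d)) * coeff p i
    -- `A n` acts first and supplies the factor for `j = 0`; `suc n ∸ suc j` computes to `n ∸ j`.
    ≈⟨ *-cong (∏<-front (λ j → w (n ∸ j) (i ℕ.+ j ℕ.* d)) n) ≈-refl ⟨
  ∏< (suc n) (λ j → w (n ∸ j) (i ℕ.+ j ℕ.* d)) * coeff p i ∎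

graded-∑ᵒ : ∀ {d A} (w : ℕ → ℕ → ℝ) → (∀ k → Graded d (w k) (A k)) → ∀ n →
  Graded d (λ i → ∑< n (λ k → w k i)) (∑ᵒ n A)
graded-∑ᵒ w g zero    = mkGraded λ p i → ≈-sym (zeroˡ _)
graded-∑ᵒ w g (suc n) = graded-⊞ (graded-∑ᵒ w g n) (g n)

graded-X↑ : ∀ d → Graded d (λ _ → 1ℝ) (X ↑ d)
graded-X↑ d = mkGraded λ p i → ≈-trans (reflexive (coeff-X↑-+ d p i)) (≈-sym (*-identityˡ _))

graded-X↑-∘ : ∀ d {w A} → Graded 0 w A → Graded d w (X ↑ d ∘′ A)
graded-X↑-∘ d {A = A} g = mkGraded λ p i → ≈-trans (reflexive
  (≡.trans (coeff-X↑-+ d (A p) i) (cong (coeff (A p)) (≡.sym (ℕ.+-identityʳ i))))) (coeff-graded g p i)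

-- Both operators are tested on the monomial `m` of degree `i`, whose coefficient there is 1.
graded-unique : ∀ {d v w A B} → (∀ p → A p ≋ B p) → Graded d v A → Graded d w B → ∀ i → v i ≈ w i
graded-unique {d} {v} {w} {A} {B} A≋B g h i = begin
  v i                       ≈⟨ *-identityʳ (v i) ⟨
  v i * 1ℝ                  ≡⟨ cong (v i *_) coeff-m ⟨
  v i * coeff m i           ≈⟨ coeff-graded g m i ⟨
  coeff (A m) (i ℕ.+ d)     ≈⟨ A≋B m (i ℕ.+ d) ⟩
  coeff (B m) (i ℕ.+ d)     ≈⟨ coeff-graded h m i ⟩
  w i * coeff m i           ≡⟨ cong (w i *_) coeff-m ⟩
  w i * 1ℝ                  ≈⟨ *-identityʳ (w i) ⟩
  w i                       ∎
  where
  m : Polynomial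
  m = (X ↑ i) (1ℝ ∷ [])
  coeff-m : coeff m i ≡ 1ℝ
  coeff-m = coeff-X↑-+ i (1ℝ ∷ []) 0

-- The operator identity as an identity of scalars.

-- `∏[1⋯_]` evaluates at `suc j`, where `j ∸ 1` computes back to the index counted from 0; the
-- product thus agrees by computation with the one produced by `graded-∏ᵒ`.
weight : ℝ → ℕ → ℕ → ℕ → ℕ → ℝ
weight lam r s n k = ∏[1⋯ n ] (λ j → falling (fromℕ (k ℕ.+ (j ∸ 1) ℕ.* (r ∸ s))) s - fromℕ (n ∸ j) * lam)

stirling-falling : ∀ {lam r s} n {S} → s ℕ.≤ r → IsDegenerateStirling₂ lam r s n S →
  ∀ m → weight lam r s n m ≈ ∑< (suc (n ℕ.* s)) (λ k → S k * falling (fromℕ m) k)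
stirling-falling {lam} {r} {s} n {S} s≤r stirling = graded-unique stirling
  (graded-∏ᵒ (λ k i → falling (fromℕ i) s - fromℕ k * lam)
    (λ k → graded-cong (λ i → +-cong ≈-refl (-‿cong (*-identityʳ _)))
      (graded-⊟ (graded-XD s≤r) (graded-⊙ (fromℕ k * lam) (graded-X↑ (r ∸ s))))) n)
  (graded-X↑-∘ (n ℕ.* (r ∸ s)) (graded-∑ᵒ (λ k i → S k * falling (fromℕ i) k)
    -- `graded-XD` with `r = s = k` yields degree shift `k ∸ k`, rewritten to 0.
    (λ k → graded-⊙ (S k) (subst (λ d → Graded d (λ i → falling (fromℕ i) k) (X ↑ k ∘′ D ↑ k))
      (ℕ.n∸n≡0 k) (graded-XD {k} ℕ.≤-refl))) (suc (n ℕ.* s))))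

-- Limits and series

Near : ℚ → ℝ → ℝ → Set
Near ε x y = Eventually (λ i → ℚ.∣ seq x i ℚ.- seq y i ∣ ℚ.≤ ε)

⟶⇒near : ∀ {f L} → f ⟶ L → ∀ ε → 0ℚ ℚ.< ε → Eventually (λ n → Near ε (f n) L)
⟶⇒near {f} {L} c ε p = mapᵉ (λ n → within⁻¹ (f n) L ε) (c ε p)

-- The strict inequality in `_⟶_` demands a positive gap below the bound; nearness within half the
-- bound provides it.
near⇒⟶ : ∀ {f L} → (∀ ε → 0ℚ ℚ.< ε → Eventually (λ n → Near ε (f n) L)) → f ⟶ L
near⇒⟶ {f} {L} c ε p = mapᵉ (λ n → within (f n) L ε p) (c (½ ℚ.* ε) (half-pos p))

near-trans : ∀ {x y z ε} → Near (½ ℚ.* ε) x y → Near (½ ℚ.* ε) y z → Near ε x z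
near-trans {x} {y} {z} p q =
  mapᵉ (λ i (a , b) → ∣-∣-triangle½ (seq x i) (seq y i) (seq z i) a b) (p ∧ᵉ q)

⟶-resp-≈ : ∀ {f g L M} → (∀ n → f n ≈ g n) → L ≈ M → f ⟶ L → g ⟶ M
⟶-resp-≈ {f} {g} {L} {M} f≈g L≈M c = near⇒⟶ λ ε p →
  -- The bound is split into one half for `g n` against `f n` and a quarter each for `f n` against
  -- `L` and `L` against `M`.
  let q = half-pos p ; r = half-pos q in
  mapᵉ (λ n f~L → near-trans {g n} {f n} {M} (close (≈-sym (f≈g n)) _ q)
      (near-trans {f n} {L} {M} f~L (close L≈M _ r)))
    (⟶⇒near c _ r)

⟶-+ : ∀ {f g L M} → f ⟶ L → g ⟶ M → (λ n → f n + g n) ⟶ L + M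
⟶-+ {f} {g} {L} {M} c d = near⇒⟶ λ ε p →
  mapᵉ (λ n (f~L , g~M) → mapᵉ (λ i (a , b) →
      +-close (seq (f n) i) (seq (g n) i) (seq L i) (seq M i) a b) (f~L ∧ᵉ g~M))
    (⟶⇒near c _ (half-pos p) ∧ᵉ ⟶⇒near d _ (half-pos p))

⟶-*ˡ : ∀ {f L} c → f ⟶ L → (λ n → c * f n) ⟶ c * L
⟶-*ˡ {f} {L} c l = near⇒⟶ λ ε p →
  let (M , ∣c∣≤M)    = bounded (seq c) (cauchy c)
      -- `δ` times the bound on the representatives of `c` is exactly `ε`.
      (δ , 0<δ , e) = divide (ι (suc M)) ε (ι-pos M) p
  in mapᵉ (λ n → mapᵉ (λ i f~L → subst₂ ℚ._≤_
        (cong ℚ.∣_∣ (ℚ-Solver.solve 3 (λ c x y → c :*ℚ (x :-ℚ y) :=ℚ c :*ℚ x :-ℚ c :*ℚ y) ≡.refl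
          (seq c i) (seq (f n) i) (seq L i)))
        e (∣*∣-mono (seq c i) (seq (f n) i ℚ.- seq L i) (∣c∣≤M i) f~L)))
      (⟶⇒near l δ 0<δ)

⟶-suc : ∀ {f L} → (f ∘ suc) ⟶ L → f ⟶ L
⟶-suc c ε p = suc (proj₁ (c ε p)) , λ { (suc n) (s≤s N≤n) → proj₂ (c ε p) n N≤n }

HasSum-resp-≈ : ∀ {a b L M} → (∀ n → a n ≈ b n) → L ≈ M → HasSum a L → HasSum b M
HasSum-resp-≈ a≈b = ⟶-resp-≈ (∑<-cong a≈b)

HasSum-+ : ∀ {a b L M} → HasSum a L → HasSum b M → HasSum (λ n → a n + b n) (L + M)
HasSum-+ {a} {b} p q = ⟶-resp-≈ (λ n → ≈-sym (∑<-+ a b n)) ≈-refl (⟶-+ p q)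

HasSum-*ˡ : ∀ {a L} c → HasSum a L → HasSum (λ n → c * a n) (c * L)
HasSum-*ˡ {a} c p = ⟶-resp-≈ (λ n → ≈-sym (∑<-*ˡ c a n)) ≈-refl (⟶-*ˡ c p)

HasSum-shift : ∀ {a L} → a 0 ≈ 0ℝ → HasSum (a ∘ suc) L → HasSum a L
HasSum-shift {a} a₀≈0 p = ⟶-suc (⟶-resp-≈ (λ n → ≈-sym
  (≈-trans (∑<-front a n) (≈-trans (+-cong a₀≈0 ≈-refl) (+-identityˡ _)))) ≈-refl p)

-- Exponential series weighted by falling factorials.

-- Induction on `k`, starting from the exponential series: the term at 0 vanishes for `suc k`, and
-- the term at `suc m` is `x` times the term at `m` for `k`.
falling-hasSum : ∀ x k → HasSum (λ m → 1/ m ! * falling (fromℕ m) k * x ^ m) (x ^ k * exp x)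
falling-hasSum x zero = HasSum-resp-≈ (λ m → *-cong (≈-sym (*-identityʳ (1/ m !))) ≈-refl)
  (≈-sym (*-identityˡ (exp x))) (exp-hasSum x)
falling-hasSum x (suc k) = HasSum-shift
  (≈-trans (*-cong (≈-trans (*-cong ≈-refl (falling-zero {m = suc k} (s≤s z≤n))) (zeroʳ _)) ≈-refl) (zeroˡ _))
  (HasSum-resp-≈ step (≈-sym (*-assoc x (x ^ k) (exp x))) (HasSum-*ˡ x (falling-hasSum x k)))
  where
  step : ∀ m → x * (1/ m ! * falling (fromℕ m) k * x ^ m)
             ≈ 1/ suc m ! * falling (fromℕ (suc m)) (suc k) * x ^ suc m
  step m = begin
    x * (1/ m ! * F * x ^ m)
      ≈⟨ *-cong ≈-refl (*-cong (*-cong (1/!-suc m) ≈-refl) ≈-refl) ⟨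
    x * (1/ suc m ! * fromℕ (suc m) * F * x ^ m)
      ≈⟨ solve 5 (λ x g n f y → x :* (g :* n :* f :* y) := g :* (n :* f) :* (x :* y)) ≈-refl
           x (1/ suc m !) (fromℕ (suc m)) F (x ^ m) ⟩
    1/ suc m ! * (fromℕ (suc m) * F) * x ^ suc m
      ≈⟨ *-cong (*-cong ≈-refl (falling-suc-suc m k)) ≈-refl ⟨
    1/ suc m ! * falling (fromℕ (suc m)) (suc k) * x ^ suc m ∎
    where F = falling (fromℕ m) k

-- The inner sum is finite, so exchanging it with the series only takes additivity and scaling of
-- `HasSum`.
falling-combination-hasSum : ∀ x (S : ℕ → ℝ) n →
  HasSum (λ m → 1/ m ! * ∑< n (λ k → S k * falling (fromℕ m) k) * x ^ m)
         (∑< n (λ k → S k * x ^ k) * exp x)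
falling-combination-hasSum x S zero = HasSum-resp-≈
  (λ m → ≈-trans (zeroˡ _) (≈-sym (≈-trans (*-cong (zeroʳ (1/ m !)) ≈-refl) (zeroˡ (x ^ m)))))
  -- The zero series is obtained as 0 times the exponential series.
  ≈-refl (HasSum-*ˡ 0ℝ (exp-hasSum x))
falling-combination-hasSum x S (suc n) = HasSum-resp-≈
  (λ m → solve 5 (λ g s c f y → g :* s :* y :+ c :* (g :* f :* y) := g :* (s :+ c :* f) :* y) ≈-refl
    (1/ m !) (∑< n (λ k → S k * falling (fromℕ m) k)) (S n) (falling (fromℕ m) n) (x ^ m))
  (solve 4 (λ t c y z → t :* z :+ c :* (y :* z) := (t :+ c :* y) :* z) ≈-refl
    (∑< n (λ k → S k * x ^ k)) (S n) (x ^ n) (exp x))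
  (HasSum-+ (falling-combination-hasSum x S n) (HasSum-*ˡ (S n) (falling-hasSum x n)))

1^n≈1 : ∀ n → 1ℝ ^ n ≈ 1ℝ
1^n≈1 zero    = ≈-refl
1^n≈1 (suc n) = ≈-trans (*-identityˡ _) (1^n≈1 n)

theorem1 : (lam : ℝ) (r s n : ℕ) → 1 ℕ.≤ s → s ℕ.≤ r → 1 ℕ.≤ n →
    (S : ℕ → ℝ) → IsDegenerateStirling₂ lam r s n S →
    ((x : ℝ) → ∃ λ T →
    HasSum (λ k → 1/ k ! *
    ∏[1⋯ n ] (λ j → falling (fromℕ (k ℕ.+ (j ∸ 1) ℕ.* (r ∸ s))) s - fromℕ (n ∸ j) * lam) * x ^ k) T
    × bellPolynomial s n S x ≈ 1/exp x * T)
    × (∃ λ T →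
    HasSum (λ k → 1/ k ! *
    ∏[1⋯ n ] (λ j → falling (fromℕ (k ℕ.+ (j ∸ 1) ℕ.* (r ∸ s))) s - fromℕ (n ∸ j) * lam)) T
    × bellPolynomial s n S 1ℝ ≈ 1/e * T)
theorem1 lam r s n _ s≤r _ S stirling =
  -- The sum of the series is known in closed form and serves as the witness `T`.
  (λ x → bell x * exp x , hasSum x , dobiński x) ,
  (bell 1ℝ * e ,
   -- At `x = 1` the powers drop out; `e` and `1/e` unfold to `exp 1ℝ` and `1/exp 1ℝ`.
   HasSum-resp-≈ (λ m → ≈-trans (*-cong ≈-refl (1^n≈1 m)) (*-identityʳ _)) ≈-refl (hasSum 1ℝ) ,
   dobiński 1ℝ)
  where
  bell : ℝ → ℝ
  bell = bellPolynomial s n S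

  hasSum : ∀ x → HasSum (λ m → 1/ m ! * weight lam r s n m * x ^ m) (bell x * exp x)
  hasSum x = HasSum-resp-≈
    (λ m → *-cong (*-cong ≈-refl (≈-sym (stirling-falling n s≤r stirling m))) ≈-refl)
    ≈-refl (falling-combination-hasSum x S (suc (n ℕ.* s)))

  dobiński : ∀ x → bell x ≈ 1/exp x * (bell x * exp x)
  dobiński x = begin
    bell x                       ≈⟨ *-identityʳ (bell x) ⟨
    bell x * 1ℝ                  ≈⟨ *-cong ≈-refl (*-inverseʳ (exp x) (exp-nonZero x)) ⟨
    bell x * (exp x * 1/exp x)   ≈⟨ solve 3 (λ b y z → b :* (y :* z) := z :* (b :* y)) ≈-refl
                                      (bell x) (exp x) (1/exp x) ⟩
    1/exp x * (bell x * exp x)   ∎
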